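{- Let $W$ be a Coxeter group with set $S$ of simple reflections. For $w\in W$, we have $\mathrm{dp}(w)=\ell_T(w)$ if and only if $\ell_S(w)=\ell_T(w)$.
   Context: $T=\{wsw^{ -1}: w\in W, s\in S\}$ is the set of all reflections of $W$. $\ell_S(w)$ (length) and $\ell_T(w)$ (reflection length) are the minimal numbers of factors in an expression of $w$ as a product of elements of $S$, respectively of $T$. Let $\Phi=\Pi\cup(-\Pi)$ be the root system associated to $(W,S)$, with $\Pi$ the positive roots; each positive root $\beta$ corresponds to a reflection $t_\beta\in T$ with $t_\beta(\beta)=-\beta$, and $\beta\mapsto t_\beta$ is a bijection $\Pi\to T$. The depth of a positive root is $\mathrm{dp}(\beta)=\min\{k : s_1\cdots s_k(\beta)\in -\Pi \text{ for some } s_1,\dots,s_k\in S\}$. The depth of $w\in W$ is $$\mathrm{dp}(w)=\min\Big\{\sum_{i=1}^k \mathrm{dp}(\beta_i) : k\ge 0,\ w=t_{\beta_1}\cdots t_{\beta_k},\ \beta_i\in\Pi\Big\},$$ with the identity being the empty product. -}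

module Defs where

open import Level using (_⊔_) renaming (suc to lsuc)
open import Algebra.Apartness.Bundles using (HeytingField)
open import Algebra.Bundles using (Group)
open import Data.Bool.Base using (if_then_else_)
open import Data.List.Base using (List; []; _∷_; _++_; map; foldr; length; concat; replicate; sum)
open import Data.List.Relation.Unary.All using (All)
open import Data.Nat.Base using (ℕ; zero; suc; NonZero) renaming (_≤_ to _≤ℕ_; _<_ to _<ℕ_)
open import Data.Nat.Properties using () renaming (_≟_ to _≟ℕ_)
open import Data.Product.Base using (Σ; ∃; ∃-syntax; _×_; _,_; proj₁; proj₂; map₂)
open import Data.Sum.Base using (_⊎_)
open import Function.Bundles using (_⇔_; Equivalence)
open import Relation.Binary.Construct.Closure.Equivalence using (EqClosure)
open import Relation.Binary.Core using (Rel)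
open import Relation.Binary.Definitions using (Cotransitive; DecidableEquality)
open import Relation.Binary.PropositionalEquality.Core using (_≡_)
open import Relation.Binary.Structures using (IsStrictPartialOrder)
open import Relation.Nullary.Decidable.Core using (does; map′)
open import Relation.Nullary.Negation.Core using (¬_)

IsMinimum : ∀ {p} → (ℕ → Set p) → ℕ → Set p
IsMinimum P n = P n × (∀ k → P k → n ≤ℕ k)

-- The order is axiomatised by its strict part, so that both the classical and
-- the constructive real numbers are ordered fields in this sense; classically
-- these are exactly the (totally) ordered fields.
record OrderedField c ℓ₁ ℓ₂ ℓ₃ : Set (lsuc (c ⊔ ℓ₁ ⊔ ℓ₂ ⊔ ℓ₃)) where
  infix 4 _<_ _≤_
  field
    heytingField : HeytingField c ℓ₁ ℓ₂

  open HeytingField heytingField public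

  field
    _<_                  : Rel Carrier ℓ₃
    isStrictPartialOrder : IsStrictPartialOrder _≈_ _<_
    <-cotrans            : Cotransitive _<_
    #⇔<⊎>                : ∀ x y → x # y ⇔ (x < y ⊎ y < x)
    +-monoˡ-<            : ∀ {x y} z → x < y → x + z < y + z
    *-pos                : ∀ {x y} → 0# < x → 0# < y → 0# < x * y

  _≤_ : Rel Carrier ℓ₃
  x ≤ y = ¬ (y < x)

module _ {c ℓ₁ ℓ₂ ℓ₃} (K : OrderedField c ℓ₁ ℓ₂ ℓ₃) where
  open OrderedField K

  -- Real and imaginary part of (x + i y)ᵏ.
  complexPower : Carrier → Carrier → ℕ → Carrier × Carrier
  complexPower x y zero    = 1# , 0#
  complexPower x y (suc k) = let (a , b) = complexPower x y k in
    (x * a - y * b) , (x * b + y * a)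

  -- x = cos(π/m) and y = sin(π/m).  Over ℝ the complex number e^{iπ/m} is the
  -- only z on the unit circle with zᵐ = -1 such that z, z², …, zᵐ⁻¹ all lie in
  -- the open upper half plane.
  record IsCosSinπ/ (m : ℕ) (x y : Carrier) : Set (ℓ₁ ⊔ ℓ₃) where
    field
      onCircle  : x * x + y * y ≈ 1#
      powerRe   : proj₁ (complexPower x y m) ≈ - 1#
      powerIm   : proj₂ (complexPower x y m) ≈ 0#
      upperHalf : ∀ k → 0 <ℕ k → k <ℕ m → 0# < proj₂ (complexPower x y k)

-- The scalars: an ordered field containing cos(π/m) and sin(π/m) for all
-- m ≥ 1, for example ℝ.  Nothing else about ℝ enters the construction of the
-- root system.
record TrigField c ℓ₁ ℓ₂ ℓ₃ : Set (lsuc (c ⊔ ℓ₁ ⊔ ℓ₂ ⊔ ℓ₃)) where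
  field
    orderedField : OrderedField c ℓ₁ ℓ₂ ℓ₃

  open OrderedField orderedField public

  field
    cosπ/ sinπ/ : (m : ℕ) .{{_ : NonZero m}} → Carrier
    isCosSinπ/  : (m : ℕ) .{{_ : NonZero m}} →
                  IsCosSinπ/ orderedField m (cosπ/ m) (sinπ/ m)

-- The value m s t = 0 encodes m(s,t) = ∞.
record CoxeterMatrix s : Set (lsuc s) where
  field
    S      : Set s
    m      : S → S → ℕ
    m-sym  : ∀ s t → m s t ≡ m t s
    m≡1⇔≡  : ∀ s t → m s t ≡ 1 ⇔ s ≡ t

  _≟_ : DecidableEquality S
  s ≟ t = map′ (Equivalence.to (m≡1⇔≡ s t)) (Equivalence.from (m≡1⇔≡ s t)) (m s t ≟ℕ 1)

  Word : Set s
  Word = List S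

  -- (s t)^m(s,t); the empty word when m(s,t) = ∞, so that no relation is imposed.
  relator : S → S → Word
  relator s t = concat (replicate (m s t) (s ∷ t ∷ []))

  data _⟶_ : Rel Word s where
    delete : ∀ u s t v → (u ++ relator s t ++ v) ⟶ (u ++ v)

  -- Equality in the group ⟨ S ∣ (s t)^m(s,t) = 1 ⟩.  Words in S suffice, without
  -- inverse letters, because m(s,s) = 1 makes each generator an involution.
  _∼_ : Rel Word s
  _∼_ = EqClosure _⟶_

-- A group W with a family of elements indexed by S, for which
-- ⟨ S ∣ (s t)^m(s,t) = 1 ⟩ is a presentation.
record CoxeterSystem w ℓ s : Set (lsuc (w ⊔ ℓ ⊔ s)) where
  field
    coxeterMatrix : CoxeterMatrix s
    group         : Group w ℓ

  open CoxeterMatrix coxeterMatrix public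
  open Group group public using (_≈_; _∙_; ε; _⁻¹) renaming (Carrier to W)

  field
    simple : S → W

  product : List W → W
  product = foldr _∙_ ε

  ⟦_⟧ : Word → W
  ⟦ u ⟧ = product (map simple u)

  field
    generated : ∀ w → ∃[ u ] w ≈ ⟦ u ⟧
    presented : ∀ u v → ⟦ u ⟧ ≈ ⟦ v ⟧ ⇔ u ∼ v

  IsReflection : W → Set (w ⊔ ℓ ⊔ s)
  IsReflection t = ∃[ x ] ∃[ s ] t ≈ x ∙ simple s ∙ x ⁻¹

  IsLength : W → ℕ → Set (ℓ ⊔ s)
  IsLength w = IsMinimum λ k → ∃[ u ] length u ≡ k × w ≈ ⟦ u ⟧

  IsReflectionLength : W → ℕ → Set (w ⊔ ℓ ⊔ s)
  IsReflectionLength w = IsMinimum λ k →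
    ∃[ ts ] length ts ≡ k × All IsReflection ts × w ≈ product ts

-- The root system of the geometric representation of W.
module RootSystem {c ℓ₁ ℓ₂ ℓ₃ w ℓ s}
  (K : TrigField c ℓ₁ ℓ₂ ℓ₃) (C : CoxeterSystem w ℓ s) where

  open TrigField K hiding (_≈_)
  open TrigField K using () renaming (_≈_ to _≈ᴷ_)
  open CoxeterSystem C

  -- The vector space with basis (α s) for s in S: formal linear combinations,
  -- two of them being equal when they have the same coefficients.
  V : Set (c ⊔ s)
  V = List (S × Carrier)

  coeff : V → S → Carrier
  coeff []            s = 0#
  coeff ((t , a) ∷ v) s = (if does (t ≟ s) then a else 0#) + coeff v s

  infix 4 _≈ⱽ_
  _≈ⱽ_ : Rel V (ℓ₁ ⊔ s)
  u ≈ⱽ v = ∀ s → coeff u s ≈ᴷ coeff v s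

  α : S → V
  α s = (s , 1#) ∷ []

  negⱽ : V → V
  negⱽ = map (map₂ (λ a → - a))

  -- -cos(π/m), or -1 for m = ∞
  formEntry : ℕ → Carrier
  formEntry zero      = - 1#
  formEntry m@(suc _) = - cosπ/ m

  -- B⟨α s , v⟩ for the bilinear form B with B⟨α s , α t⟩ = -cos(π/m(s,t))
  B⟨α_,_⟩ : S → V → Carrier
  B⟨α s , [] ⟩          = 0#
  B⟨α s , (t , a) ∷ v ⟩ = a * formEntry (m s t) + B⟨α s , v ⟩

  -- v ↦ v - 2 B⟨α s , v⟩ α s
  σ : S → V → V
  σ s v = (s , - ((1# + 1#) * B⟨α s , v ⟩)) ∷ v

  -- The action of W on V, on words: act (s₁ ∷ … ∷ sₖ ∷ []) v = s₁ (… (sₖ v)).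
  act : Word → V → V
  act u v = foldr σ v u

  IsRoot : V → Set (ℓ₁ ⊔ s)
  IsRoot β = ∃[ u ] ∃[ s ] β ≈ⱽ act u (α s)

  IsPositiveRoot : V → Set (ℓ₁ ⊔ ℓ₃ ⊔ s)
  IsPositiveRoot β = IsRoot β × (∀ s → 0# ≤ coeff β s)

  IsNegativeRoot : V → Set (ℓ₁ ⊔ ℓ₃ ⊔ s)
  IsNegativeRoot β = IsPositiveRoot (negⱽ β)

  -- t = t_β: if β = x (α s) with x in W, then t_β = x s x⁻¹.
  IsReflectionOf : V → W → Set (ℓ₁ ⊔ ℓ ⊔ s)
  IsReflectionOf β t =
    ∃[ u ] ∃[ s ] β ≈ⱽ act u (α s) × t ≈ ⟦ u ⟧ ∙ simple s ∙ ⟦ u ⟧ ⁻¹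

  IsRootDepth : V → ℕ → Set (ℓ₁ ⊔ ℓ₃ ⊔ s)
  IsRootDepth β = IsMinimum λ k → ∃[ u ] length u ≡ k × IsNegativeRoot (act u β)

  -- A positive root together with its reflection and its depth.
  record Factor : Set (c ⊔ ℓ₁ ⊔ ℓ₃ ⊔ w ⊔ ℓ ⊔ s) where
    field
      root         : V
      positive     : IsPositiveRoot root
      reflection   : W
      isReflection : IsReflectionOf root reflection
      depth        : ℕ
      isDepth      : IsRootDepth root depth

  IsDepth : W → ℕ → Set (c ⊔ ℓ₁ ⊔ ℓ₃ ⊔ w ⊔ ℓ ⊔ s)
  IsDepth w = IsMinimum λ k → Σ (List Factor) λ fs →
    sum (map Factor.depth fs) ≡ k × w ≈ product (map Factor.reflection fs)

{-# OPTIONS --safe #-}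

-- Every positive root has depth at least 1, and a root of depth 1 is simple.
-- Hence ℓ_T ≤ dp, and dp w = ℓ_T w forces every factor of a minimal expression
-- of w to be a simple reflection, so that ℓ_S w = ℓ_T w; conversely an
-- expression of w in simple reflections is one in roots of depth 1.
--
-- That a root β = u(α r) of depth 1 is α s follows from B(β,β) = 1; that its
-- reflection is then s in W needs the geometric representation to be faithful.
-- This is the theorem that u(α r) is either nonnegative, or nonpositive with
-- ℓ(u r) < ℓ(u).  The word problem is not decidable a priori, so the theorem is
-- proved for words u instead of group elements: in the second case a word for
-- u r shorter than u is constructed.  Induct on the length of u = u′ t.  For
-- t ≠ r, move letters t and r from the end of v to the front of x, starting
-- from u = v x with v = u′ and x = t.  Once v(α t) and v(α r) are nonnegative,
-- the sign of u(α r) is found in the dihedral group generated by t and r.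
module Submission where

open import Defs
open import Level using (0ℓ; _⊔_)
open import Algebra.Apartness.Bundles using (module HeytingCommutativeRing)
import Algebra.Apartness.Properties.HeytingCommutativeRing
open import Algebra.Bundles using (CommutativeRing; Group; RawRing)
import Algebra.Properties.AbelianGroup
import Algebra.Properties.CommutativeSemigroup
import Algebra.Properties.Ring
import Algebra.Properties.Semiring.Mult
import Algebra.Properties.Semiring.Mult.TCOptimised
import Algebra.Solver.Ring
open import Algebra.Solver.Ring.AlmostCommutativeRing using (fromCommutativeRing; _-Raw-AlmostCommutative⟶_)
open import Data.Bool.Base using (true; false; if_then_else_)
open import Data.Empty using (⊥-elim)
open import Data.List.Base using (List; []; _∷_; _++_; _∷ʳ_; map; length; concat; replicate; initLast; _∷ʳ′_)
import Data.List.Properties as List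
open import Data.List.Relation.Unary.All as All using (All; []; _∷_)
import Data.List.Relation.Unary.All.Properties as All
open import Data.Maybe.Base using (Maybe; just; nothing)
open import Data.Nat.Base as ℕ using (ℕ; zero; suc)
open import Data.Nat.ListAction using (sum)
import Data.Nat.Properties as ℕ
open import Data.Product.Base using (_×_; _,_; proj₁; proj₂; ∃-syntax; map₂)
open import Data.Sum.Base using (_⊎_; inj₁; inj₂)
open import Function.Base using (_∘_)
open import Function.Bundles using (Equivalence; _⇔_; mk⇔)
open import Relation.Binary.Construct.Closure.ReflexiveTransitive as Star using (_◅_)
open import Relation.Binary.Construct.Closure.Symmetric using (fwd; bwd)
open import Relation.Binary.PropositionalEquality as ≡ using (_≡_; _≢_)
import Relation.Binary.Reasoning.Setoid as SetoidReasoning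
open import Relation.Binary.Structures using (IsStrictPartialOrder)
open import Relation.Nullary.Decidable using (does; yes; no; dec-true; dec-false)
open import Relation.Nullary.Negation.Core using (¬_)

-- Ring solver with integer coefficients.

-- The ring solver needs coefficients on which equality is decided, so that
-- terms cancel.  It compares normal forms syntactically, so the difference
-- p - q, encoded as (p , q), is always reduced.
module IntegerSolver {c ℓ} (R : CommutativeRing c ℓ) where
  open CommutativeRing R hiding (zero)
  open Algebra.Properties.Ring ring
  open Algebra.Properties.AbelianGroup +-abelianGroup using (⁻¹-∙-comm; ε⁻¹≈ε)
  open Algebra.Properties.Semiring.Mult semiring using (×-homo-+; ×1-homo-*) renaming (_×_ to infixr 8 _·_)
  open Algebra.Properties.Semiring.Mult.TCOptimised semiring using (×ᵤ≈×) renaming (_×_ to infixr 8 _×′_)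
  open Algebra.Properties.CommutativeSemigroup +-commutativeSemigroup using (interchange)
  open SetoidReasoning setoid

  differences : RawRing 0ℓ 0ℓ
  differences = record
    { Carrier = ℕ × ℕ
    ; _≈_ = _≡_
    ; _+_ = λ (p , q) (p′ , q′) → reduce (p ℕ.+ p′ , q ℕ.+ q′)
    ; _*_ = λ (p , q) (p′ , q′) → reduce (p ℕ.* p′ ℕ.+ q ℕ.* q′ , p ℕ.* q′ ℕ.+ q ℕ.* p′)
    ; -_ = λ (p , q) → q , p
    ; 0# = 0 , 0
    ; 1# = 1 , 0
    }
    where
    reduce : ℕ × ℕ → ℕ × ℕ
    reduce (p , q) = p ℕ.∸ q , q ℕ.∸ p

  open RawRing differences using () renaming (Carrier to D; _+_ to _⊕_; _*_ to _⊛_; -_ to ⊖_)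

  -- The separate case for `zero`, with the optimised multiples, makes `value (0 , 0)` and
  -- `value (1 , 0)` reduce to `0#` and `1#`, so that `:0` and `:1` match these constants in goals.
  value : D → Carrier
  value (p , zero)      = p ×′ 1#
  value (p , q@(suc _)) = p ×′ 1# - q ×′ 1#

  private
    difference : D → Carrier
    difference (p , q) = p · 1# - q · 1#

    value≈difference : ∀ d → value d ≈ difference d
    value≈difference (p , zero)      = begin
      p ×′ 1#       ≈⟨ ×ᵤ≈× p 1# ⟨
      p · 1#        ≈⟨ +-identityʳ _ ⟨
      p · 1# + 0#   ≈⟨ +-congˡ ε⁻¹≈ε ⟨
      p · 1# - 0#   ∎
    value≈difference (p , q@(suc _)) =
      sym (+-cong (×ᵤ≈× p 1#) (-‿cong (×ᵤ≈× q 1#)))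

    difference-cong : ∀ p q p′ q′ → p ℕ.+ q′ ≡ p′ ℕ.+ q → difference (p , q) ≈ difference (p′ , q′)
    difference-cong p q p′ q′ p+q′≡p′+q = begin
      p · 1# - q · 1#
        ≈⟨ +-congʳ (trans (sym (+-identityʳ _)) (+-congˡ (sym (-‿inverseʳ (q′ · 1#))))) ⟩
      (p · 1# + (q′ · 1# - q′ · 1#)) - q · 1#
        ≈⟨ +-congʳ (trans (sym (+-assoc _ _ _)) (+-congʳ (sym (×-homo-+ 1# p q′)))) ⟩
      ((p ℕ.+ q′) · 1# - q′ · 1#) - q · 1#
        ≡⟨ ≡.cong (λ n → (n · 1# - q′ · 1#) - q · 1#) p+q′≡p′+q ⟩
      ((p′ ℕ.+ q) · 1# - q′ · 1#) - q · 1#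
        ≈⟨ +-congʳ (+-congʳ (×-homo-+ 1# p′ q)) ⟩
      ((p′ · 1# + q · 1#) - q′ · 1#) - q · 1#
        ≈⟨ trans (+-assoc _ _ _) (interchange _ _ _ _) ⟩
      (p′ · 1# - q′ · 1#) + (q · 1# - q · 1#)
        ≈⟨ trans (+-congˡ (-‿inverseʳ _)) (+-identityʳ _) ⟩
      p′ · 1# - q′ · 1# ∎

    difference-reduce : ∀ p q → difference (p ℕ.∸ q , q ℕ.∸ p) ≈ difference (p , q)
    difference-reduce p q = difference-cong (p ℕ.∸ q) (q ℕ.∸ p) p q (max p q)
      where
      max : ∀ p q → p ℕ.∸ q ℕ.+ q ≡ p ℕ.+ (q ℕ.∸ p)
      max zero    zero    = ≡.refl
      max zero    (suc q) = ≡.refl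
      max (suc p) zero    = ≡.refl
      max (suc p) (suc q) = ≡.trans (ℕ.+-suc (p ℕ.∸ q) q) (≡.cong suc (max p q))

    difference-+ : ∀ d e → difference (d ⊕ e) ≈ difference d + difference e
    difference-+ (p , q) (p′ , q′) = trans (difference-reduce (p ℕ.+ p′) (q ℕ.+ q′)) (begin
      (p ℕ.+ p′) · 1# - (q ℕ.+ q′) · 1#
        ≈⟨ +-cong (×-homo-+ 1# p p′) (trans (-‿cong (×-homo-+ 1# q q′)) (sym (⁻¹-∙-comm _ _))) ⟩
      (p · 1# + p′ · 1#) + (- (q · 1#) - q′ · 1#)
        ≈⟨ interchange _ _ _ _ ⟩
      difference (p , q) + difference (p′ , q′) ∎)

    difference-neg : ∀ d → difference (⊖ d) ≈ - difference d
    difference-neg (p , q) = begin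
      q · 1# - p · 1#         ≈⟨ +-comm _ _ ⟩
      - (p · 1#) + q · 1#     ≈⟨ +-congˡ (-‿involutive _) ⟨
      - (p · 1#) - - (q · 1#) ≈⟨ ⁻¹-∙-comm _ _ ⟩
      - (p · 1# - q · 1#)     ∎

    sum-of-products : ∀ a b p q → ((a ℕ.* p ℕ.+ b ℕ.* q) · 1#) ≈ a · 1# * p · 1# + b · 1# * q · 1#
    sum-of-products a b p q = trans (×-homo-+ 1# (a ℕ.* p) (b ℕ.* q)) (+-cong (×1-homo-* a p) (×1-homo-* b q))

    difference-* : ∀ d e → difference (d ⊛ e) ≈ difference d * difference e
    difference-* (p , q) (p′ , q′) = trans
      (difference-reduce (p ℕ.* p′ ℕ.+ q ℕ.* q′) (p ℕ.* q′ ℕ.+ q ℕ.* p′)) (begin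
      (p ℕ.* p′ ℕ.+ q ℕ.* q′) · 1# - (p ℕ.* q′ ℕ.+ q ℕ.* p′) · 1#
        ≈⟨ +-cong (sum-of-products p q p′ q′) (-‿cong (sum-of-products p q q′ p′)) ⟩
      (P * P′ + Q * Q′) - (P * Q′ + Q * P′)
        ≈⟨ +-congˡ (trans (-‿cong (+-comm _ _)) (sym (⁻¹-∙-comm _ _))) ⟩
      (P * P′ + Q * Q′) + (- (Q * P′) - P * Q′)
        ≈⟨ interchange _ _ _ _ ⟩
      (P * P′ - Q * P′) + (Q * Q′ - P * Q′)
        ≈⟨ +-cong (+-congˡ (-‿distribˡ-* Q P′)) (trans (+-comm _ _) (+-cong (-‿distribʳ-* P Q′)
             (trans (sym (-‿involutive _)) (trans (-‿cong (-‿distribˡ-* Q Q′)) (-‿distribʳ-* (- Q) Q′))))) ⟩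
      (P * P′ + - Q * P′) + (P * - Q′ + - Q * - Q′)
        ≈⟨ +-cong (distribʳ P′ P (- Q)) (distribʳ (- Q′) P (- Q)) ⟨
      (P - Q) * P′ + (P - Q) * - Q′
        ≈⟨ distribˡ (P - Q) P′ (- Q′) ⟨
      (P - Q) * (P′ - Q′) ∎)
      where
      P = p · 1#
      Q = q · 1#
      P′ = p′ · 1#
      Q′ = q′ · 1#

    morphism : differences -Raw-AlmostCommutative⟶ fromCommutativeRing R
    morphism = record
      { ⟦_⟧    = value
      ; +-homo = λ d e → trans (value≈difference (d ⊕ e)) (trans (difference-+ d e)
                   (sym (+-cong (value≈difference d) (value≈difference e))))
      ; *-homo = λ d e → trans (value≈difference (d ⊛ e)) (trans (difference-* d e)
                   (sym (*-cong (value≈difference d) (value≈difference e))))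
      ; -‿homo = λ d → trans (value≈difference (⊖ d)) (trans (difference-neg d)
                   (sym (-‿cong (value≈difference d))))
      ; 0-homo = refl
      ; 1-homo = refl
      }

    _≟_ : ∀ d e → Maybe (value d ≈ value e)
    d@(p , q) ≟ e@(p′ , q′) with p ℕ.+ q′ ℕ.≟ p′ ℕ.+ q
    ... | no _ = nothing
    ... | yes p+q′≡p′+q = just (trans (value≈difference d)
      (trans (difference-cong p q p′ q′ p+q′≡p′+q) (sym (value≈difference e))))

  open Algebra.Solver.Ring differences (fromCommutativeRing R) morphism _≟_ public
    using (Polynomial; solve; con; _:=_; _:+_; _:*_; :-_; _:-_)

  :0 :1 : ∀ {n} → Polynomial n
  :0 = con (0 , 0)
  :1 = con (1 , 0)

-- Signs and inverses in an ordered field, without deciding the order.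

module OrderedFieldProperties {c ℓ₁ ℓ₂ ℓ₃} (F : OrderedField c ℓ₁ ℓ₂ ℓ₃) where
  open OrderedField F hiding (zero)
  open HeytingCommutativeRing heytingCommutativeRing using (commutativeRing)
  open Algebra.Apartness.Properties.HeytingCommutativeRing heytingCommutativeRing using (1#0)
  open IsStrictPartialOrder isStrictPartialOrder public
    using () renaming (asym to <-asym; irrefl to <-irrefl; <-respʳ-≈ to <-respʳ; <-respˡ-≈ to <-respˡ)
  open IntegerSolver commutativeRing public
  module ≈-Reasoning = SetoidReasoning (CommutativeRing.setoid commutativeRing)

  -- Lets the solver work modulo known equations: nested uses exhibit the difference of the two
  -- sides as a combination of equations `a ≈ b` with weights `k`, and only a polynomial identity
  -- remains.
  add-multiple : ∀ {a b x y} k → a ≈ b → x ≈ y + k * (a - b) → x ≈ y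
  add-multiple {a} {b} {x} {y} k a≈b x≈ = trans x≈ (trans (+-congˡ (trans (*-congˡ
    (trans (+-congʳ a≈b) (-‿inverseʳ b))) (solve 1 (λ k → k :* :0 := :0) refl k))) (+-identityʳ y))

  x<0⇒0<-x : ∀ {x} → x < 0# → 0# < - x
  x<0⇒0<-x {x} x<0 = <-respʳ (+-identityˡ _) (<-respˡ (-‿inverseʳ x) (+-monoˡ-< (- x) x<0))

  0<x⇒-x<0 : ∀ {x} → 0# < x → - x < 0#
  0<x⇒-x<0 {x} 0<x = <-respʳ (-‿inverseʳ x) (<-respˡ (+-identityˡ _) (+-monoˡ-< (- x) 0<x))

  0<1 : 0# < 1#
  0<1 with Equivalence.to (#⇔<⊎> 1# 0#) 1#0
  ... | inj₁ 1<0 = <-respʳ (solve 0 (:- :1 :* :- :1 := :1) refl) (*-pos (x<0⇒0<-x 1<0) (x<0⇒0<-x 1<0))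
  ... | inj₂ 0<1 = 0<1

  0≉1 : ¬ (0# ≈ 1#)
  0≉1 0≈1 = <-irrefl 0≈1 0<1

  0<⇒0≤ : ∀ {x} → 0# < x → 0# ≤ x
  0<⇒0≤ 0<x x<0 = <-asym 0<x x<0

  0≤-resp : ∀ {x y} → x ≈ y → 0# ≤ x → 0# ≤ y
  0≤-resp x≈y 0≤x y<0 = 0≤x (<-respˡ (sym x≈y) y<0)

  0≤0 : ∀ {x} → x ≈ 0# → 0# ≤ x
  0≤0 x≈0 = <-irrefl x≈0

  -- Cotransitivity compares `x + y` with the endpoints of 0 < y; the alternative x + y < y would
  -- make x negative.
  0≤+0< : ∀ {x y} → 0# ≤ x → 0# < y → 0# < x + y
  0≤+0< {x} {y} 0≤x 0<y with <-cotrans 0<y (x + y)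
  ... | inj₁ 0<x+y = 0<x+y
  ... | inj₂ x+y<y = ⊥-elim (0≤x (<-respʳ (-‿inverseʳ y)
    (<-respˡ (solve 2 (λ x y → x :+ y :- y := x) refl x y) (+-monoˡ-< (- y) x+y<y))))

  0≤-+ : ∀ {x y} → 0# ≤ x → 0# ≤ y → 0# ≤ x + y
  0≤-+ {x} {y} 0≤x 0≤y x+y<0 = 0≤y (<-respʳ (+-identityˡ 0#) (<-respˡ
    (solve 2 (λ x y → :- (:- y) := y) refl x y) (<-respʳ (sym (+-identityˡ 0#)) (0<x⇒-x<0
      (<-respʳ (solve 2 (λ x y → x :+ :- (x :+ y) := :- y) refl x y) (0≤+0< 0≤x (x<0⇒0<-x x+y<0)))))))

  #0-factorˡ : ∀ {x y} → x * y # 0# → x # 0#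
  #0-factorˡ {x} {y} xy#0 with #⇒invertible xy#0
  ... | z , zxy≈1 , _ = invertible⇒#
    (z * y , trans (solve 3 (λ x y z → z :* y :* (x :- :0) := z :* (x :* y :- :0)) refl x y z) zxy≈1
           , trans (solve 3 (λ x y z → (x :- :0) :* (z :* y) := z :* (x :* y :- :0)) refl x y z) zxy≈1)

  0≤∧#0⇒0< : ∀ {x} → 0# ≤ x → x # 0# → 0# < x
  0≤∧#0⇒0< 0≤x x#0 with Equivalence.to (#⇔<⊎> _ _) x#0
  ... | inj₁ x<0 = ⊥-elim (0≤x x<0)
  ... | inj₂ 0<x = 0<x

  -- A nonnegative element is not known to be zero or positive. But a negative product is apart from
  -- zero, hence so are its factors; these are then positive, and so is the product.
  0≤-* : ∀ {x y} → 0# ≤ x → 0# ≤ y → 0# ≤ x * y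
  0≤-* {x} {y} 0≤x 0≤y xy<0 = <-asym xy<0 (*-pos
    (0≤∧#0⇒0< 0≤x (#0-factorˡ xy#0)) (0≤∧#0⇒0< 0≤y (#0-factorˡ yx#0)))
    where
    xy#0 : x * y # 0#
    xy#0 = Equivalence.from (#⇔<⊎> _ _) (inj₁ xy<0)
    yx#0 : y * x # 0#
    yx#0 = Equivalence.from (#⇔<⊎> _ _) (inj₁ (<-respˡ (*-comm x y) xy<0))

  0≤-antisym : ∀ {x} → 0# ≤ x → 0# ≤ - x → x ≈ 0#
  0≤-antisym {x} 0≤x 0≤-x = proj₁ (tight x 0#) (λ x#0 → 0≤-x (0<x⇒-x<0 (0≤∧#0⇒0< 0≤x x#0)))

  0≤-cancel-* : ∀ {x y} → 0# < y → 0# ≤ y * x → 0# ≤ x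
  0≤-cancel-* {x} {y} 0<y 0≤yx x<0 = 0≤yx (<-respˡ (solve 2 (λ x y → :- (y :* :- x) := y :* x) refl x y)
    (0<x⇒-x<0 (*-pos 0<y (x<0⇒0<-x x<0))))

  inverse : ∀ {y} → 0# < y → Carrier
  inverse 0<y = proj₁ (#⇒invertible (Equivalence.from (#⇔<⊎> _ 0#) (inj₂ 0<y)))

  inverse-* : ∀ {y} (0<y : 0# < y) → inverse 0<y * y ≈ 1#
  inverse-* {y} 0<y = trans (*-congˡ (solve 1 (λ y → y := y :- :0) refl y))
    (proj₁ (proj₂ (#⇒invertible (Equivalence.from (#⇔<⊎> y 0#) (inj₂ 0<y)))))

  *-cancelˡ-pos : ∀ {x x′ y} → 0# < y → y * x ≈ y * x′ → x ≈ x′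
  *-cancelˡ-pos {x} {x′} {y} 0<y yx≈yx′ = add-multiple (x′ - x) (inverse-* 0<y)
    (add-multiple (inverse 0<y) yx≈yx′ (solve 4 (λ x x′ y i →
      x := x′ :+ (x′ :- x) :* (i :* y :- :1) :+ i :* (y :* x :- y :* x′)) refl x x′ y (inverse 0<y)))

  0≤∧²≈1⇒≈1 : ∀ {x} → 0# ≤ x → x * x ≈ 1# → x ≈ 1#
  0≤∧²≈1⇒≈1 {x} 0≤x xx≈1 = *-cancelˡ-pos (0≤+0< 0≤x 0<1)
    (add-multiple 1# xx≈1 (solve 1 (λ x → (x :+ :1) :* x := (x :+ :1) :* :1 :+ :1 :* (x :* x :- :1)) refl x))

  -- Second-order recurrences and the sines of multiples of π/m.

  -- For e = - cos θ, these are the linear combinations of sin(kθ) and cos(kθ).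
  Recurrent : Carrier → (ℕ → Carrier) → Set ℓ₁
  Recurrent e f = ∀ k → f (2 ℕ.+ k) ≈ - ((1# + 1#) * e) * f (1 ℕ.+ k) - f k

  module _ {m x y} (isCosSin : IsCosSinπ/ F m x y) (0<y : 0# < y) where
    open IsCosSinπ/ isCosSin

    module _ (f : ℕ → Carrier) (f-rec : Recurrent (- x) f) where
      private
        re im : ℕ → Carrier
        re k = proj₁ (complexPower F x y k)
        im k = proj₂ (complexPower F x y k)

      -- For x = cos θ and y = sin θ this reads sin θ f(k) = f(1) sin kθ - f(0) sin((k-1)θ). Both
      -- sides agree at 0 and 1 and satisfy the same recurrence, the right one because x² + y² = 1.
      closedForm : ∀ k → y * f k ≈ f 1 * im k + f 0 * (y * re k - x * im k)
      closedForm zero          = solve 4 (λ x y f₀ f₁ →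
        y :* f₀ := f₁ :* :0 :+ f₀ :* (y :* :1 :- x :* :0)) refl x y (f 0) (f 1)
      closedForm (suc zero)    = solve 4 (λ x y f₀ f₁ →
        y :* f₁ := f₁ :* (x :* :0 :+ y :* :1)
          :+ f₀ :* (y :* (x :* :1 :- y :* :0) :- x :* (x :* :0 :+ y :* :1)))
        refl x y (f 0) (f 1)
      closedForm (suc (suc k)) =
        add-multiple y (f-rec k) (add-multiple (- ((1# + 1#) * - x)) (closedForm (suc k)) (add-multiple (- 1#) (closedForm k)
        (add-multiple (f 1 * im k + f 0 * (y * re k - x * im k)) onCircle
        (solve 9 (λ x y f₀ f₁ S C g₀ g₁ g₂ →
          let C′ = x :* C :- y :* S
              S′ = x :* S :+ y :* C
              2x = :- ((:1 :+ :1) :* :- x)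
              g  = f₁ :* S :+ f₀ :* (y :* C :- x :* S)
              g′ = f₁ :* S′ :+ f₀ :* (y :* C′ :- x :* S′)
          in y :* g₂ := f₁ :* (x :* S′ :+ y :* C′)
               :+ f₀ :* (y :* (x :* C′ :- y :* S′) :- x :* (x :* S′ :+ y :* C′))
               :+ y :* (g₂ :- (2x :* g₁ :- g₀))
               :+ 2x :* (y :* g₁ :- g′)
               :+ :- :1 :* (y :* g₀ :- g)
               :+ g :* (x :* x :+ y :* y :- :1))
          refl x y (f 0) (f 1) (im k) (re k) (f k) (f (suc k)) (f (suc (suc k)))))))

      half-turn₀ : f m ≈ - f 0
      half-turn₀ = *-cancelˡ-pos 0<y (add-multiple 1# (closedForm m)
        (add-multiple (f 1 - f 0 * x) powerIm (add-multiple (f 0 * y) powerRe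
        (solve 7 (λ x y f₀ f₁ S C g → y :* g := y :* :- f₀ :+ :1 :* (y :* g :- (f₁ :* S :+ f₀ :* (y :* C :- x :* S)))
           :+ (f₁ :- f₀ :* x) :* (S :- :0) :+ f₀ :* y :* (C :- :- :1)) refl x y (f 0) (f 1) (im m) (re m) (f m)))))

    -- A shift of a recurrent sequence is recurrent, so it is enough to evaluate the closed form at
    -- m, where the sine is 0 and the cosine is -1.
    half-turn : ∀ f → Recurrent (- x) f → ∀ k → f (k ℕ.+ m) ≈ - f k
    half-turn f f-rec k = trans (half-turn₀ (λ j → f (k ℕ.+ j)) shifted)
      (-‿cong (reflexive (≡.cong f (ℕ.+-identityʳ k))))
      where
      shifted : ∀ j → f (k ℕ.+ (2 ℕ.+ j)) ≈ - ((1# + 1#) * - x) * f (k ℕ.+ (1 ℕ.+ j)) - f (k ℕ.+ j)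
      shifted j rewrite ℕ.+-suc k (suc j) | ℕ.+-suc k j = f-rec (k ℕ.+ j)

    full-turn : ∀ f → Recurrent (- x) f → ∀ k → f (k ℕ.+ m ℕ.* 2) ≈ f k
    full-turn f f-rec k = trans (reflexive (≡.cong f k+2m≡[k+m]+m)) (trans (half-turn f f-rec (k ℕ.+ m))
      (trans (-‿cong (half-turn f f-rec k)) (solve 1 (λ x → :- (:- x) := x) refl (f k))))
      where
      k+2m≡[k+m]+m : k ℕ.+ m ℕ.* 2 ≡ k ℕ.+ m ℕ.+ m
      k+2m≡[k+m]+m = ≡.trans (≡.cong (k ℕ.+_) (≡.trans (ℕ.*-comm m 2) (≡.cong (m ℕ.+_) (ℕ.+-identityʳ m))))
        (≡.sym (ℕ.+-assoc k m m))

  recurrence : Carrier → Carrier → Carrier → ℕ → Carrier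
  recurrence e p q zero          = p
  recurrence e p q (suc zero)    = q
  recurrence e p q (suc (suc k)) = - ((1# + 1#) * e) * recurrence e p q (suc k) - recurrence e p q k

  -- U e k = sin(kθ) / sin θ, where e = - cos θ.
  U : Carrier → ℕ → Carrier
  U e = recurrence e 0# 1#

  -- Multiplication by sin θ > 0 turns `U` into sin kθ, which vanishes at k = 0 and k = m and is
  -- positive in between by `upperHalf`.
  U-nonneg-finite : ∀ {m x y} → IsCosSinπ/ F m x y → 0# < y → ∀ k → k ℕ.≤ m → 0# ≤ U (- x) k
  U-nonneg-finite {m} {x} {y} isCosSin 0<y k k≤m = 0≤-cancel-* 0<y (0≤-resp (sym y*U≈im) (im-nonneg k k≤m))
    where
    open IsCosSinπ/ isCosSin

    im : ℕ → Carrier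
    im k = proj₂ (complexPower F x y k)

    y*U≈im : y * U (- x) k ≈ im k
    y*U≈im = trans (closedForm isCosSin 0<y (U (- x)) (λ _ → refl) k)
      (solve 2 (λ s a → :1 :* s :+ :0 :* a := s) refl (im k) (y * proj₁ (complexPower F x y k) - x * im k))

    im-nonneg : ∀ k → k ℕ.≤ m → 0# ≤ im k
    im-nonneg zero    _   = 0≤0 refl
    im-nonneg (suc k) k<m with ℕ.m≤n⇒m<n∨m≡n k<m
    ... | inj₁ 1+k<m  = 0<⇒0≤ (upperHalf (suc k) ℕ.z<s 1+k<m)
    ... | inj₂ ≡.refl = 0≤0 powerIm

  -- For m = ∞ the sequence degenerates to U(k) = k, so the induction carries the constant
  -- difference 1.
  U-nonneg-infinite : ∀ k → 0# ≤ U (- 1#) k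
  U-nonneg-infinite k = proj₁ (linear k)
    where
    linear : ∀ k → 0# ≤ U (- 1#) k × (U (- 1#) (suc k) ≈ U (- 1#) k + 1#)
    linear zero    = 0≤0 refl , sym (+-identityˡ 1#)
    linear (suc k) with linear k
    ... | 0≤u , u′≈u+1 = 0≤-resp (sym u′≈u+1) (0≤-+ 0≤u (0<⇒0≤ 0<1)) ,
      add-multiple 1# u′≈u+1 (solve 2 (λ u u′ →
        :- ((:1 :+ :1) :* :- :1) :* u′ :- u := u′ :+ :1 :+ :1 :* (u′ :- (u :+ :1)))
        refl (U (- 1#) k) (U (- 1#) (suc k)))

-- Linear algebra on formal combinations of simple roots.

module GeometricRepresentation {c ℓ₁ ℓ₂ ℓ₃ w ℓ s}
  (K : TrigField c ℓ₁ ℓ₂ ℓ₃) (C : CoxeterSystem w ℓ s) where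
  open TrigField K hiding (zero)
  open OrderedFieldProperties orderedField public
  open CoxeterSystem C using (S; m; m-sym; m≡1⇔≡; _≟_; Word)
  open RootSystem K C

  if-cong : ∀ b {a a′} → a ≈ a′ → (if b then a else 0#) ≈ (if b then a′ else 0#)
  if-cong true  a≈a′ = a≈a′
  if-cong false a≈a′ = refl

  -- Both the coefficients and the pairings with simple roots have this shape, so compatibility with
  -- `≈ⱽ` needs only one proof.
  linear : (S → Carrier) → V → Carrier
  linear f []            = 0#
  linear f ((t , a) ∷ v) = a * f t + linear f v

  B≡linear : ∀ s v → B⟨α s , v ⟩ ≡ linear (λ t → formEntry (m s t)) v
  B≡linear s []            = ≡.refl
  B≡linear s ((t , a) ∷ v) = ≡.cong (a * formEntry (m s t) +_) (B≡linear s v)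

  linear-pointwise : ∀ {f g} → (∀ s → f s ≈ g s) → ∀ v → linear f v ≈ linear g v
  linear-pointwise f≈g []            = refl
  linear-pointwise f≈g ((t , a) ∷ v) = +-cong (*-congˡ (f≈g t)) (linear-pointwise f≈g v)

  linear-*-+ : ∀ a f g v → linear (λ s → a * f s + g s) v ≈ a * linear f v + linear g v
  linear-*-+ a f g []            = solve 1 (λ a → :0 := a :* :0 :+ :0) refl a
  linear-*-+ a f g ((t , b) ∷ v) = trans (+-congˡ (linear-*-+ a f g v)) (solve 6 (λ a b ft gt x y →
    b :* (a :* ft :+ gt) :+ (a :* x :+ y) := a :* (b :* ft :+ x) :+ (b :* gt :+ y)) refl
    a b (f t) (g t) (linear f v) (linear g v))

  linear-0 : ∀ v → linear (λ _ → 0#) v ≈ 0#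
  linear-0 []            = refl
  linear-0 ((t , a) ∷ v) = trans (+-congˡ (linear-0 v)) (solve 1 (λ a → a :* :0 :+ :0 := :0) refl a)

  linear-swap : ∀ (f : S → S → Carrier) x y →
                linear (λ s → linear (f s) y) x ≈ linear (λ t → linear (λ s → f s t) x) y
  linear-swap f []            y = sym (linear-0 y)
  linear-swap f ((s , a) ∷ x) y = trans (+-congˡ (linear-swap f x y))
    (sym (linear-*-+ a (f s) (λ t → linear (λ s → f s t) x) y))

  private
    zeroAt : S → (S → Carrier) → S → Carrier
    zeroAt s f t = if does (t ≟ s) then 0# else f t

    zeroAt-zero : ∀ s f t → f t ≈ 0# → zeroAt s f t ≈ 0#
    zeroAt-zero s f t ft≈0 with does (t ≟ s)
    ... | true  = refl
    ... | false = ft≈0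

    zeroAt-self : ∀ s f → zeroAt s f s ≈ 0#
    zeroAt-self s f = reflexive (≡.cong (if_then 0# else f s) (dec-true (s ≟ s) ≡.refl))

    zeroAt-split : ∀ s f a t → a * f t ≈ a * zeroAt s f t + (if does (t ≟ s) then a else 0#) * f s
    zeroAt-split s f a t with t ≟ s
    ... | yes ≡.refl = trans (solve 2 (λ a fs → a :* fs := a :* :0 :+ a :* fs) refl a (f s))
      (reflexive (≡.cong (λ b → a * (if b then 0# else f s) + (if b then a else 0#) * f s)
        (≡.sym (dec-true (s ≟ s) ≡.refl))))
    ... | no t≢s     = trans (solve 3 (λ a ft fs → a :* ft := a :* ft :+ :0 :* fs) refl a (f t) (f s))
      (reflexive (≡.cong (λ b → a * (if b then 0# else f t) + (if b then a else 0#) * f s)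
        (≡.sym (dec-false (t ≟ s) t≢s))))

    linear-zeroAt : ∀ s f v → linear f v ≈ linear (zeroAt s f) v + coeff v s * f s
    linear-zeroAt s f []            = solve 1 (λ fs → :0 := :0 :+ :0 :* fs) refl (f s)
    linear-zeroAt s f ((t , a) ∷ v) = trans (+-cong (zeroAt-split s f a t) (linear-zeroAt s f v))
      (solve 6 (λ az d fs l k x → (az :+ d :* fs) :+ (l :+ k :* fs) := (az :+ l) :+ (d :+ k) :* fs) refl
        (a * zeroAt s f t) (if does (t ≟ s) then a else 0#) (f s) (linear (zeroAt s f) v) (coeff v s) a)

    zeroOn : V → (S → Carrier) → S → Carrier
    zeroOn []            f = f
    zeroOn ((t , _) ∷ v) f = zeroAt t (zeroOn v f)

    zeroOn-self : ∀ (v : V) f → All (λ ta → zeroOn v f (proj₁ ta) ≈ 0#) v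
    zeroOn-self []            f = []
    zeroOn-self ((t , a) ∷ v) f = zeroAt-self t (zeroOn v f)
      ∷ All.map (λ {(u , _)} → zeroAt-zero t (zeroOn v f) u) (zeroOn-self v f)

    linear-zeroOn : ∀ x f v → v ≈ⱽ [] → linear f v ≈ linear (zeroOn x f) v
    linear-zeroOn []            f v v≈0 = refl
    linear-zeroOn ((t , _) ∷ x) f v v≈0 = trans (linear-zeroOn x f v v≈0)
      (add-multiple (zeroOn x f t) (v≈0 t) (trans (linear-zeroAt t (zeroOn x f) v)
        (solve 3 (λ l k ft → l :+ k :* ft := l :+ ft :* (k :- :0)) refl
          (linear (zeroAt t (zeroOn x f)) v) (coeff v t) (zeroOn x f t))))

    linear-vanishing : ∀ f {v : V} → All (λ ta → f (proj₁ ta) ≈ 0#) v → linear f v ≈ 0#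
    linear-vanishing f [] = refl
    linear-vanishing f {(t , a) ∷ v} (ft≈0 ∷ f≈0) = trans (+-cong (*-congˡ ft≈0) (linear-vanishing f f≈0))
      (solve 1 (λ a → a :* :0 :+ :0 := :0) refl a)

    -- A list with zero coefficients may still have entries that cancel. Resetting `f` to zero at t
    -- changes the value by `coeff v t * f t`, which is zero; after this is done for every t in the
    -- list, each summand vanishes.
    linear-null : ∀ f v → v ≈ⱽ [] → linear f v ≈ 0#
    linear-null f v v≈0 = trans (linear-zeroOn v f v v≈0) (linear-vanishing (zeroOn v f) (zeroOn-self v f))

  scale : Carrier → V → V
  scale k = map (map₂ (k *_))

  linear-++ : ∀ f u v → linear f (u ++ v) ≈ linear f u + linear f v
  linear-++ f []            v = sym (+-identityˡ _)
  linear-++ f ((t , a) ∷ u) v = trans (+-congˡ (linear-++ f u v)) (sym (+-assoc _ _ _))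

  linear-scale : ∀ f k v → linear f (scale k v) ≈ k * linear f v
  linear-scale f k []            = solve 1 (λ k → :0 := k :* :0) refl k
  linear-scale f k ((t , a) ∷ v) = trans (+-congˡ (linear-scale f k v))
    (solve 4 (λ k a ft l → k :* a :* ft :+ k :* l := k :* (a :* ft :+ l)) refl k a (f t) (linear f v))

  coeff≈linear : ∀ v s → coeff v s ≈ linear (λ t → if does (t ≟ s) then 1# else 0#) v
  coeff≈linear []            s = refl
  coeff≈linear ((t , a) ∷ v) s = +-cong (select (does (t ≟ s))) (coeff≈linear v s)
    where
    select : ∀ b → (if b then a else 0#) ≈ a * (if b then 1# else 0#)
    select true  = sym (*-identityʳ a)
    select false = solve 1 (λ a → :0 := a :* :0) refl a

  -- Sums, multiples and equality (k = 1, z = 0) are all of this form, so one lemma per map gives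
  -- its linearity.
  IsCombination : V → Carrier → V → V → Set _
  IsCombination x k y z = ∀ s → coeff x s ≈ k * coeff y s + coeff z s

  -- The list for -x + ky + z has zero coefficients, so every functional vanishes on it. The
  -- expansion is used twice: for `f`, and for the coefficient functionals themselves.
  linear-combination : ∀ f {x k y z} → IsCombination x k y z → linear f x ≈ k * linear f y + linear f z
  linear-combination f {x} {k} {y} {z} x≈ky+z = add-multiple 1# -x+[ky+z]≈0
    (solve 4 (λ x y z k → x := k :* y :+ z :+ :1 :* (:0 :- (:- :1 :* x :+ (k :* y :+ z)))) refl
      (linear f x) (linear f y) (linear f z) k)
    where
    difference : V
    difference = scale (- 1#) x ++ scale k y ++ z

    expand : ∀ f → linear f difference ≈ - 1# * linear f x + (k * linear f y + linear f z)
    expand f = trans (linear-++ f (scale (- 1#) x) _) (+-cong (linear-scale f _ x)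
      (trans (linear-++ f (scale k y) z) (+-congʳ (linear-scale f k y))))

    difference≈0 : difference ≈ⱽ []
    difference≈0 s = trans (coeff≈linear difference s) (trans (expand _) (trans (+-cong
      (*-congˡ (sym (coeff≈linear x s))) (+-cong (*-congˡ (sym (coeff≈linear y s))) (sym (coeff≈linear z s))))
      (add-multiple (- 1#) (x≈ky+z s) (solve 4 (λ x y z k →
        :- :1 :* x :+ (k :* y :+ z) := :0 :+ :- :1 :* (x :- (k :* y :+ z))) refl
        (coeff x s) (coeff y s) (coeff z s) k))))

    -x+[ky+z]≈0 : 0# ≈ - 1# * linear f x + (k * linear f y + linear f z)
    -x+[ky+z]≈0 = trans (sym (linear-null f difference difference≈0)) (expand f)

  linear-cong : ∀ f {x y} → x ≈ⱽ y → linear f x ≈ linear f y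
  linear-cong f {x} {y} x≈y = trans (linear-combination f {x} {1#} {y} {[]}
    (λ s → trans (x≈y s) (sym (1*a+0 _)))) (1*a+0 _)
    where
    1*a+0 : ∀ a → 1# * a + 0# ≈ a
    1*a+0 = solve 1 (λ a → :1 :* a :+ :0 := a) refl

  coeff-negⱽ : ∀ v s → coeff (negⱽ v) s ≈ - coeff v s
  coeff-negⱽ []            s = solve 0 (:0 := :- :0) refl
  coeff-negⱽ ((t , a) ∷ v) s = trans (+-cong (negate (does (t ≟ s))) (coeff-negⱽ v s))
    (solve 2 (λ a b → :- a :+ :- b := :- (a :+ b)) refl _ _)
    where
    negate : ∀ b → (if b then - a else 0#) ≈ - (if b then a else 0#)
    negate true  = refl
    negate false = solve 0 (:0 := :- :0) refl

  B-combination : ∀ s {x k y z} → IsCombination x k y z → B⟨α s , x ⟩ ≈ k * B⟨α s , y ⟩ + B⟨α s , z ⟩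
  B-combination s {x} {k} {y} {z} x≈ky+z rewrite B≡linear s x | B≡linear s y | B≡linear s z =
    linear-combination _ {x} {k} {y} {z} x≈ky+z

  B-cong : ∀ s {x y} → x ≈ⱽ y → B⟨α s , x ⟩ ≈ B⟨α s , y ⟩
  B-cong s {x} {y} x≈y rewrite B≡linear s x | B≡linear s y = linear-cong _ {x} {y} x≈y

  σ-cong : ∀ s {x y} → x ≈ⱽ y → σ s x ≈ⱽ σ s y
  σ-cong s {x} {y} x≈y r = +-cong (if-cong (does (s ≟ r)) (-‿cong (*-congˡ (B-cong s {x} {y} x≈y)))) (x≈y r)

  σ-combination : ∀ s {x k y z} → IsCombination x k y z → IsCombination (σ s x) k (σ s y) (σ s z)
  σ-combination s {x} {k} {y} {z} x≈ky+z r = trans (+-cong (select (does (s ≟ r))) (x≈ky+z r))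
    (solve 5 (λ k a b c d → (k :* a :+ b) :+ (k :* c :+ d) := k :* (a :+ c) :+ (b :+ d)) refl k _ _ _ _)
    where
    β : V → Carrier
    β v = - ((1# + 1#) * B⟨α s , v ⟩)

    select : ∀ b → (if b then β x else 0#) ≈ k * (if b then β y else 0#) + (if b then β z else 0#)
    select true  = trans (-‿cong (*-congˡ (B-combination s {x} {k} {y} {z} x≈ky+z)))
      (solve 3 (λ k b c → :- ((:1 :+ :1) :* (k :* b :+ c)) := k :* (:- ((:1 :+ :1) :* b)) :+ :- ((:1 :+ :1) :* c)) refl
        k (B⟨α s , y ⟩) (B⟨α s , z ⟩))
    select false = solve 1 (λ k → :0 := k :* :0 :+ :0) refl k

  act-cong : ∀ u {x y} → x ≈ⱽ y → act u x ≈ⱽ act u y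
  act-cong []      x≈y = x≈y
  act-cong (s ∷ u) {x} {y} x≈y = σ-cong s {act u x} {act u y} (act-cong u {x} {y} x≈y)

  act-combination : ∀ u {x k y z} → IsCombination x k y z → IsCombination (act u x) k (act u y) (act u z)
  act-combination []      x≈ky+z = x≈ky+z
  act-combination (s ∷ u) {x} {k} {y} {z} x≈ky+z =
    σ-combination s {act u x} {k} {act u y} {act u z} (act-combination u {x} {k} {y} {z} x≈ky+z)

  act-++ : ∀ u v x → act (u ++ v) x ≡ act u (act v x)
  act-++ u v x = List.foldr-++ σ x u v

  -- The list `act u []` need not be empty; linearity applied to 0 = 1 · 0 + 0 gives a = a + a for
  -- each coefficient.
  act-[] : ∀ u → act u [] ≈ⱽ []
  act-[] u r = add-multiple (- 1#) (act-combination u {[]} {1#} {[]} {[]} (λ _ → solve 0 (:0 := :1 :* :0 :+ :0) refl) r)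
    (solve 1 (λ a → a := :0 :+ :- :1 :* (a :- (:1 :* a :+ a))) refl (coeff (act u []) r))

  act-∷ : ∀ u s a v → IsCombination (act u ((s , a) ∷ v)) a (act u (α s)) (act u v)
  act-∷ u s a v = act-combination u {(s , a) ∷ v} {a} {α s} {v} (λ r → +-congʳ (select (does (s ≟ r))))
    where
    select : ∀ b → (if b then a else 0#) ≈ a * ((if b then 1# else 0#) + 0#)
    select true  = solve 1 (λ a → a := a :* (:1 :+ :0)) refl a
    select false = solve 1 (λ a → :0 := a :* (:0 :+ :0)) refl a

  -- The invariant bilinear form and the planes of two simple roots.

  formEntry-1 : formEntry 1 ≈ 1#
  formEntry-1 = add-multiple (- 1#) (IsCosSinπ/.powerRe (isCosSinπ/ 1)) (solve 2 (λ x y →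
    :- x := :1 :+ :- :1 :* ((x :* :1 :- y :* :0) :- :- :1)) refl (cosπ/ 1) (sinπ/ 1))

  m-self : ∀ s → m s s ≡ 1
  m-self s = Equivalence.from (m≡1⇔≡ s s) ≡.refl

  formEntry-self : ∀ s → formEntry (m s s) ≈ 1#
  formEntry-self s rewrite m-self s = formEntry-1

  B-σ : ∀ s v → B⟨α s , σ s v ⟩ ≈ - B⟨α s , v ⟩
  B-σ s v = trans (+-congʳ (*-congˡ (formEntry-self s)))
    (solve 1 (λ b → :- ((:1 :+ :1) :* b) :* :1 :+ b := :- b) refl _)

  σ-involutive : ∀ s v → σ s (σ s v) ≈ⱽ v
  σ-involutive s v r = select (does (s ≟ r))
    where
    select : ∀ b → (if b then - ((1# + 1#) * B⟨α s , σ s v ⟩) else 0#)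
      + ((if b then - ((1# + 1#) * B⟨α s , v ⟩) else 0#) + coeff v r) ≈ coeff v r
    select true  = trans (+-congʳ (-‿cong (*-congˡ (B-σ s v))))
      (solve 2 (λ b x → :- ((:1 :+ :1) :* :- b) :+ (:- ((:1 :+ :1) :* b) :+ x) := x) refl _ _)
    select false = solve 1 (λ x → :0 :+ (:0 :+ x) := x) refl _

  form : V → V → Carrier
  form x y = linear (λ s → B⟨α s , y ⟩) x

  form-sym : ∀ x y → form x y ≈ form y x
  form-sym x y = begin
    linear (λ s → B⟨α s , y ⟩) x
      ≈⟨ linear-pointwise (λ s → reflexive (B≡linear s y)) x ⟩
    linear (λ s → linear (λ t → formEntry (m s t)) y) x
      ≈⟨ linear-swap (λ s t → formEntry (m s t)) x y ⟩
    linear (λ t → linear (λ s → formEntry (m s t)) x) y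
      ≈⟨ linear-pointwise (λ t → trans (linear-pointwise (λ s → reflexive (≡.cong formEntry (m-sym s t))) x)
           (reflexive (≡.sym (B≡linear t x)))) y ⟩
    linear (λ t → B⟨α t , x ⟩) y ∎
    where open ≈-Reasoning

  form-congˡ : ∀ {x x′} y → x ≈ⱽ x′ → form x y ≈ form x′ y
  form-congˡ {x} {x′} y x≈x′ = linear-cong _ {x} {x′} x≈x′

  form-σ : ∀ s x y → form (σ s x) (σ s y) ≈ form x y
  form-σ s x y = trans (+-cong (*-congˡ (B-σ s y)) (trans (form-sym x (σ s y)) (+-congˡ (form-sym y x))))
    (solve 3 (λ a b f → :- ((:1 :+ :1) :* a) :* :- b :+ (:- ((:1 :+ :1) :* b) :* a :+ f) := f) refl
      (B⟨α s , x ⟩) (B⟨α s , y ⟩) (form x y))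

  form-act : ∀ u x y → form (act u x) (act u y) ≈ form x y
  form-act []      x y = refl
  form-act (s ∷ u) x y = trans (form-σ s (act u x) (act u y)) (form-act u x y)

  form-α : ∀ s y → form (α s) y ≈ B⟨α s , y ⟩
  form-α s y = solve 1 (λ b → :1 :* b :+ :0 := b) refl _

  B-α-self : ∀ s → B⟨α s , α s ⟩ ≈ 1#
  B-α-self s = trans (+-congʳ (*-congˡ (formEntry-self s))) (solve 0 (:1 :* :1 :+ :0 := :1) refl)

  form-root : ∀ {β} u s → β ≈ⱽ act u (α s) → form β β ≈ 1#
  form-root {β} u s β≈ = begin
    form β β                           ≈⟨ form-congˡ {β} {act u (α s)} β β≈ ⟩
    form (act u (α s)) β               ≈⟨ form-sym (act u (α s)) β ⟩
    form β (act u (α s))               ≈⟨ form-congˡ {β} {act u (α s)} (act u (α s)) β≈ ⟩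
    form (act u (α s)) (act u (α s))   ≈⟨ form-act u (α s) (α s) ⟩
    form (α s) (α s)                   ≈⟨ form-α s (α s) ⟩
    B⟨α s , α s ⟩                      ≈⟨ B-α-self s ⟩
    1# ∎
    where open ≈-Reasoning

  root≉0 : ∀ {β} → IsRoot β → ¬ (β ≈ⱽ [])
  root≉0 {β} (u , s , β≈) β≈0 = 0≉1 (trans (sym (form-congˡ {β} {[]} β β≈0)) (form-root {β} u s β≈))

  -- The new coordinate at `s` is the term following q, p in a `Recurrent` sequence. Thus
  -- alternating words act on the plane by shifting such a sequence.
  σ-plane : ∀ s t p q v → B⟨α s , v ⟩ ≈ 0# →
            σ s ((t , p) ∷ (s , q) ∷ v) ≈ⱽ (s , - ((1# + 1#) * formEntry (m s t)) * p - q) ∷ (t , p) ∷ v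
  σ-plane s t p q v Bv≈0 r = select (does (s ≟ r)) (if does (t ≟ r) then p else 0#)
    where
    e : Carrier
    e = formEntry (m s t)

    select : ∀ b x → (if b then - ((1# + 1#) * (p * e + (q * formEntry (m s s) + B⟨α s , v ⟩))) else 0#)
                     + (x + ((if b then q else 0#) + coeff v r))
                   ≈ (if b then - ((1# + 1#) * e) * p - q else 0#) + (x + coeff v r)
    select true  x = trans (+-congʳ (-‿cong (*-congˡ (+-congˡ (+-cong (*-congˡ (formEntry-self s)) Bv≈0)))))
      (solve 5 (λ e p q x y → :- ((:1 :+ :1) :* (p :* e :+ (q :* :1 :+ :0))) :+ (x :+ (q :+ y))
        := :- ((:1 :+ :1) :* e) :* p :- q :+ (x :+ y)) refl e p q x _)
    select false x = +-congˡ (+-congˡ (+-identityˡ _))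

  act-alternating : ∀ s t f → Recurrent (formEntry (m s t)) f →
                    ∀ v → B⟨α s , v ⟩ ≈ 0# → B⟨α t , v ⟩ ≈ 0# → ∀ n →
                    act (concat (replicate n (s ∷ t ∷ []))) ((s , f 1) ∷ (t , f 0) ∷ v)
                      ≈ⱽ (s , f (suc (n ℕ.* 2))) ∷ (t , f (n ℕ.* 2)) ∷ v
  act-alternating s t f f-rec v Bsv Btv zero    r = refl
  act-alternating s t f f-rec v Bsv Btv (suc n) r = begin
    coeff (σ s (σ t (act [st]ⁿ x₀))) r
      ≈⟨ act-cong (s ∷ t ∷ []) {act [st]ⁿ x₀} {x₁} (act-alternating s t f f-rec v Bsv Btv n) r ⟩
    coeff (σ s (σ t x₁)) r
      ≈⟨ σ-cong s {σ t x₁} {x₂} (λ r → trans (σ-plane t s _ _ v Btv r) (+-congʳ (if-cong (does (t ≟ r))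
           (trans (reflexive (≡.cong (λ M → - ((1# + 1#) * formEntry M) * f (suc k) - f k) (m-sym t s)))
             (sym (f-rec k)))))) r ⟩
    coeff (σ s x₂) r
      ≈⟨ trans (σ-plane s t _ _ v Bsv r) (+-congʳ (if-cong (does (s ≟ r)) (sym (f-rec (suc k))))) ⟩
    coeff ((s , f (3 ℕ.+ k)) ∷ (t , f (2 ℕ.+ k)) ∷ v) r ∎
    where
    open ≈-Reasoning
    k : ℕ
    k = n ℕ.* 2
    [st]ⁿ : Word
    [st]ⁿ = concat (replicate n (s ∷ t ∷ []))
    x₀ x₁ x₂ : V
    x₀ = (s , f 1) ∷ (t , f 0) ∷ v
    x₁ = (s , f (suc k)) ∷ (t , f k) ∷ v
    x₂ = (t , f (2 ℕ.+ k)) ∷ (s , f (suc k)) ∷ v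

  -- This is `upperHalf` at k = 1, available only for m > 1, since sin π = 0.
  sin-pos : ∀ n → 0# < sinπ/ (2 ℕ.+ n)
  sin-pos n = <-respʳ (solve 2 (λ x y → x :* :0 :+ y :* :1 := y) refl _ _)
    (IsCosSinπ/.upperHalf (isCosSinπ/ (2 ℕ.+ n)) 1 (ℕ.s≤s ℕ.z≤n) (ℕ.s≤s (ℕ.s≤s ℕ.z≤n)))

-- The Coxeter relations hold in the geometric representation.

module WellDefinedAction {c ℓ₁ ℓ₂ ℓ₃ w ℓ s}
  (K : TrigField c ℓ₁ ℓ₂ ℓ₃) (C : CoxeterSystem w ℓ s) where
  open GeometricRepresentation K C
  open TrigField K hiding (zero)
  open CoxeterSystem C using (S; m; m-sym; m≡1⇔≡; _≟_; Word; relator; _⟶_; delete; _∼_; ⟦_⟧; presented)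
    renaming (_≈_ to _≈ᵂ_)
  open RootSystem K C

  -- For 1 < m(s,t) < ∞, the form is nondegenerate on the plane of α s and α t,
  -- so that v is the sum of a plane vector and a vector fixed by s and t.
  act-rotation : ∀ s t n → m s t ≡ 2 ℕ.+ n → ∀ v → act (concat (replicate (2 ℕ.+ n) (s ∷ t ∷ []))) v ≈ⱽ v
  act-rotation s t n mst≡M v r = begin
    coeff (act [st]ᴹ v) r
      ≈⟨ act-cong [st]ᴹ {v} {(s , a) ∷ (t , b) ∷ v₀} (λ r → sym (v₀-split r)) r ⟩
    coeff (act [st]ᴹ ((s , f 1) ∷ (t , f 0) ∷ v₀)) r
      ≈⟨ act-alternating s t f f-rec v₀ Bsv₀ Btv₀ (2 ℕ.+ n) r ⟩
    coeff ((s , f (1 ℕ.+ M ℕ.* 2)) ∷ (t , f (0 ℕ.+ M ℕ.* 2)) ∷ v₀) r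
      ≈⟨ +-cong (if-cong (does (s ≟ r)) (turn 1)) (+-congʳ (if-cong (does (t ≟ r)) (turn 0))) ⟩
    coeff ((s , a) ∷ (t , b) ∷ v₀) r
      ≈⟨ v₀-split r ⟩
    coeff v r ∎
    where
    open ≈-Reasoning
    M : ℕ
    M = 2 ℕ.+ n
    [st]ᴹ : Word
    [st]ᴹ = concat (replicate M (s ∷ t ∷ []))
    x y p q i a b : Carrier
    x = cosπ/ M
    y = sinπ/ M
    p = B⟨α s , v ⟩
    q = B⟨α t , v ⟩
    -- Cramer's rule for a - x b = p and b - x a = q, whose determinant is 1 - x² = y². The vector
    -- with coordinates a, b then has the same pairings with `α s` and `α t` as `v`.
    i = inverse (*-pos (sin-pos n) (sin-pos n))
    a = i * (p + x * q)
    b = i * (q + x * p)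
    v₀ : V
    v₀ = (s , - a) ∷ (t , - b) ∷ v

    f : ℕ → Carrier
    f = recurrence (- x) b a

    f-rec : Recurrent (formEntry (m s t)) f
    f-rec = ≡.subst (λ m → Recurrent (formEntry m) f) (≡.sym mst≡M) (λ _ → refl)

    -- The word has 2M letters and shifts `f` by 2M places, a rotation by 2π.
    turn : ∀ k → f (k ℕ.+ M ℕ.* 2) ≈ f k
    turn = full-turn (isCosSinπ/ M) (sin-pos n) f (λ _ → refl)

    v₀-split : (s , a) ∷ (t , b) ∷ v₀ ≈ⱽ v
    v₀-split r = cancel (does (s ≟ r)) (does (t ≟ r))
      where
      cancel : ∀ β γ → (if β then a else 0#) + ((if γ then b else 0#) +
               ((if β then - a else 0#) + ((if γ then - b else 0#) + coeff v r))) ≈ coeff v r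
      cancel true  true  = solve 3 (λ a b z → a :+ (b :+ (:- a :+ (:- b :+ z))) := z) refl a b (coeff v r)
      cancel true  false = solve 2 (λ a z → a :+ (:0 :+ (:- a :+ (:0 :+ z))) := z) refl a (coeff v r)
      cancel false true  = solve 2 (λ b z → :0 :+ (b :+ (:0 :+ (:- b :+ z))) := z) refl b (coeff v r)
      cancel false false = solve 1 (λ z → :0 :+ (:0 :+ (:0 :+ (:0 :+ z))) := z) refl (coeff v r)

    perpendicular : ∀ p q → - (i * (p + x * q)) * 1# + (- (i * (q + x * p)) * - x + p) ≈ 0#
    perpendicular p q = add-multiple (- p) (inverse-* (*-pos (sin-pos n) (sin-pos n)))
      (add-multiple (- (p * i)) (trans (sym (IsCosSinπ/.onCircle (isCosSinπ/ M))) refl)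
      (solve 5 (λ x y p q i → :- (i :* (p :+ x :* q)) :* :1 :+ (:- (i :* (q :+ x :* p)) :* :- x :+ p)
        := :0 :+ :- p :* (i :* (y :* y) :- :1) :+ :- (p :* i) :* (:1 :- (x :* x :+ y :* y))) refl x y p q i))

    Bsv₀ : B⟨α s , v₀ ⟩ ≈ 0#
    Bsv₀ = trans (+-cong (*-congˡ (formEntry-self s))
      (+-congʳ (*-congˡ (reflexive (≡.cong formEntry mst≡M))))) (perpendicular p q)

    Btv₀ : B⟨α t , v₀ ⟩ ≈ 0#
    Btv₀ = trans (+-cong (*-congˡ (reflexive (≡.cong formEntry (≡.trans (m-sym t s) mst≡M))))
      (+-congʳ (*-congˡ (formEntry-self t))))
      (trans (solve 3 (λ u v w → u :+ (v :+ w) := v :+ (u :+ w)) refl _ _ _) (perpendicular q p))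

  act-relator : ∀ s t v → act (relator s t) v ≈ⱽ v
  act-relator s t v r = helper (m s t) ≡.refl
    where
    helper : ∀ M → m s t ≡ M → coeff (act (concat (replicate M (s ∷ t ∷ []))) v) r ≈ coeff v r
    helper zero          _   = refl
    helper (suc zero)    m≡1 with Equivalence.to (m≡1⇔≡ s t) m≡1
    ... | ≡.refl = σ-involutive s v r
    helper (suc (suc n)) m≡M = act-rotation s t n m≡M v r

  act-⟶ : ∀ {u u′} → u ⟶ u′ → ∀ v → act u v ≈ⱽ act u′ v
  act-⟶ (delete u s t u′) v r rewrite act-++ u (relator s t ++ u′) v | act-++ (relator s t) u′ v | act-++ u u′ v =
    act-cong u {act (relator s t) (act u′ v)} {act u′ v} (act-relator s t (act u′ v)) r

  act-∼ : ∀ {u u′} → u ∼ u′ → ∀ v → act u v ≈ⱽ act u′ v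
  act-∼ Star.ε           v r = refl
  act-∼ (fwd u⟶u″ ◅ u″∼) v r = trans (act-⟶ u⟶u″ v r) (act-∼ u″∼ v r)
  act-∼ (bwd u″⟶u ◅ u″∼) v r = trans (sym (act-⟶ u″⟶u v r)) (act-∼ u″∼ v r)

  act-resp : ∀ {u u′} → ⟦ u ⟧ ≈ᵂ ⟦ u′ ⟧ → ∀ v → act u v ≈ⱽ act u′ v
  act-resp {u} {u′} u≈u′ = act-∼ (Equivalence.to (presented u u′) u≈u′)

-- Words, cancellation and braid relations.

module CoxeterWords {w ℓ s} (C : CoxeterSystem w ℓ s) where
  open CoxeterSystem C
  open Group group using (refl; sym; trans; ∙-cong; ∙-congˡ; ∙-congʳ; assoc; identityˡ; identityʳ)

  length-∷ʳ : ∀ (u : Word) s → length (u ∷ʳ s) ≡ suc (length u)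
  length-∷ʳ u s = ≡.trans (List.length-++ u) (ℕ.+-comm (length u) 1)

  ⟦++⟧ : ∀ u v → ⟦ u ++ v ⟧ ≈ ⟦ u ⟧ ∙ ⟦ v ⟧
  ⟦++⟧ []      v = sym (identityˡ _)
  ⟦++⟧ (s ∷ u) v = trans (∙-congˡ (⟦++⟧ u v)) (sym (assoc _ _ _))

  ⟦⟧-congʳ : ∀ u v v′ → ⟦ v ⟧ ≈ ⟦ v′ ⟧ → ⟦ u ++ v ⟧ ≈ ⟦ u ++ v′ ⟧
  ⟦⟧-congʳ u v v′ v≈v′ = trans (⟦++⟧ u v) (trans (∙-congˡ v≈v′) (sym (⟦++⟧ u v′)))

  ⟦⟧-congˡ : ∀ u u′ v → ⟦ u ⟧ ≈ ⟦ u′ ⟧ → ⟦ u ++ v ⟧ ≈ ⟦ u′ ++ v ⟧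
  ⟦⟧-congˡ u u′ v u≈u′ = trans (⟦++⟧ u v) (trans (∙-congʳ u≈u′) (sym (⟦++⟧ u′ v)))

  ⟦relator⟧ : ∀ s t → ⟦ relator s t ⟧ ≈ ε
  ⟦relator⟧ s t = Equivalence.from (presented (relator s t) [])
    (fwd (≡.subst (_⟶ []) (List.++-identityʳ (relator s t)) (delete [] s t [])) ◅ Star.ε)

  simple² : ∀ s → simple s ∙ simple s ≈ ε
  simple² s = trans (∙-congˡ (sym (identityʳ _)))
    (≡.subst (λ M → ⟦ concat (replicate M (s ∷ s ∷ [])) ⟧ ≈ ε)
      (Equivalence.from (m≡1⇔≡ s s) ≡.refl) (⟦relator⟧ s s))

  simple-cancel : ∀ s x → simple s ∙ (simple s ∙ x) ≈ x
  simple-cancel s x = trans (sym (assoc _ _ _)) (trans (∙-congʳ (simple² s)) (identityˡ x))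

  simple-transpose : ∀ s {x y} → simple s ∙ x ≈ y → x ≈ simple s ∙ y
  simple-transpose s sx≈y = trans (sym (simple-cancel s _)) (∙-congˡ sx≈y)

  ∷ʳ-cancel : ∀ u s → ⟦ (u ∷ʳ s) ∷ʳ s ⟧ ≈ ⟦ u ⟧
  ∷ʳ-cancel u s = trans (⟦++⟧ (u ∷ʳ s) _) (trans (∙-congʳ (⟦++⟧ u _)) (trans (assoc _ _ _)
    (trans (∙-congˡ (trans (∙-cong (identityʳ _) (identityʳ _)) (simple² s))) (identityʳ _))))

  ∷ʳ-transpose : ∀ u s v → ⟦ u ∷ʳ s ⟧ ≈ ⟦ v ⟧ → ⟦ u ⟧ ≈ ⟦ v ∷ʳ s ⟧
  ∷ʳ-transpose u s v us≈v = trans (sym (∷ʳ-cancel u s)) (⟦⟧-congˡ (u ∷ʳ s) v (s ∷ []) us≈v)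

  alternating : S → S → ℕ → Word
  alternating a b zero    = []
  alternating a b (suc n) = a ∷ alternating b a n

  length-alternating : ∀ a b n → length (alternating a b n) ≡ n
  length-alternating a b zero    = ≡.refl
  length-alternating a b (suc n) = ≡.cong suc (length-alternating b a n)

  replicate-alternating : ∀ a b n → concat (replicate n (a ∷ b ∷ [])) ≡ alternating a b (n ℕ.* 2)
  replicate-alternating a b zero    = ≡.refl
  replicate-alternating a b (suc n) = ≡.cong (λ u → a ∷ b ∷ u) (replicate-alternating a b n)

  -- Letters are involutions, so those of the prefix move one at a time to the other side. Each move
  -- exchanges the two letters, which is why both orders are treated together.
  alternating-transpose : ∀ a b p n →
    ⟦ alternating a b (p ℕ.+ n) ⟧ ≈ ε → ⟦ alternating b a (p ℕ.+ n) ⟧ ≈ ε →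
    ⟦ alternating a b n ⟧ ≈ ⟦ alternating b a p ⟧ × ⟦ alternating b a n ⟧ ≈ ⟦ alternating a b p ⟧
  alternating-transpose a b zero    n ab≈ε ba≈ε = ab≈ε , ba≈ε
  alternating-transpose a b (suc p) n ab≈ε ba≈ε
    with alternating-transpose a b p (suc n) (shift a b ab≈ε) (shift b a ba≈ε)
    where
    shift : ∀ a b → ⟦ alternating a b (suc p ℕ.+ n) ⟧ ≈ ε → ⟦ alternating a b (p ℕ.+ suc n) ⟧ ≈ ε
    shift a b = ≡.subst (λ k → ⟦ alternating a b k ⟧ ≈ ε) (≡.sym (ℕ.+-suc p n))
  ... | a∙ba≈ba , b∙ab≈ab = simple-transpose b b∙ab≈ab , simple-transpose a a∙ba≈ba

  -- The 2j + 2 letters of the relator split into j and j + 2. In this form the braid relation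
  -- removes two letters.
  braid : ∀ a b j → m a b ≡ suc j → ⟦ alternating a b (2 ℕ.+ j) ⟧ ≈ ⟦ alternating b a j ⟧
  braid a b j mab≡1+j = proj₁ (alternating-transpose a b j (2 ℕ.+ j) (period a b mab≡1+j)
    (period b a (≡.trans (m-sym b a) mab≡1+j)))
    where
    period : ∀ a b → m a b ≡ suc j → ⟦ alternating a b (j ℕ.+ (2 ℕ.+ j)) ⟧ ≈ ε
    period a b mab≡1+j = ≡.subst (λ u → ⟦ u ⟧ ≈ ε) (≡.trans
      (≡.cong (λ M → concat (replicate M (a ∷ b ∷ []))) mab≡1+j) (≡.trans (replicate-alternating a b (suc j))
      (≡.cong (alternating a b) (begin
        2 ℕ.+ j ℕ.* 2     ≡⟨ ≡.cong (2 ℕ.+_) (≡.trans (ℕ.*-comm j 2) (≡.cong (j ℕ.+_) (ℕ.+-identityʳ j))) ⟩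
        2 ℕ.+ (j ℕ.+ j)   ≡⟨ ≡.trans (ℕ.+-suc j (suc j)) (≡.cong suc (ℕ.+-suc j j)) ⟨
        j ℕ.+ (2 ℕ.+ j)   ∎)))) (⟦relator⟧ a b)
      where open ≡.≡-Reasoning

-- Every root is nonnegative or nonpositive, and negativity shortens words.

module SignTheorem {c ℓ₁ ℓ₂ ℓ₃ w ℓ s}
  (K : TrigField c ℓ₁ ℓ₂ ℓ₃) (C : CoxeterSystem w ℓ s) where
  open CoxeterWords C
  open GeometricRepresentation K C
  open WellDefinedAction K C
  open TrigField K hiding (zero; _<_; _≤_)
  open TrigField K using () renaming (_≤_ to _≤ᴷ_)
  open CoxeterSystem C using (S; m; m-sym; m≡1⇔≡; _≟_; Word; ⟦_⟧)
    renaming (_≈_ to _≈ᵂ_)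
  module W = Group (CoxeterSystem.group C)
  open RootSystem K C
  open import Data.Nat.Base using (_<_; _≤_)

  Nonneg Nonpos : V → Set _
  Nonneg v = ∀ s → 0# ≤ᴷ coeff v s
  Nonpos v = ∀ s → 0# ≤ᴷ - coeff v s

  RightDescent : Word → S → Set _
  RightDescent u s = ∃[ u′ ] length u′ < length u × ⟦ u ⟧ ≈ᵂ ⟦ u′ ∷ʳ s ⟧

  Signed : Word → S → Set _
  Signed u s = Nonneg (act u (α s)) ⊎ (Nonpos (act u (α s)) × RightDescent u s)

  -- The bound on the lengths keeps the word witnessing the descent shorter than `u`.
  Signed-resp : ∀ {u u′ s} → ⟦ u ⟧ ≈ᵂ ⟦ u′ ⟧ → length u′ ≤ length u → Signed u′ s → Signed u s
  Signed-resp {u} {u′} {s} u≈u′ u′≤u (inj₁ 0≤) =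
    inj₁ λ r → 0≤-resp (sym (act-resp {u} {u′} u≈u′ (α s) r)) (0≤ r)
  Signed-resp {u} {u′} {s} u≈u′ u′≤u (inj₂ (≤0 , u″ , u″<u′ , u′≈u″s)) =
    inj₂ ((λ r → 0≤-resp (-‿cong (sym (act-resp {u} {u′} u≈u′ (α s) r))) (≤0 r))
         , u″ , ℕ.<-≤-trans u″<u′ u′≤u , W.trans u≈u′ u′≈u″s)

  act-plane : ∀ u a b p q r → coeff (act u ((a , p) ∷ (b , q) ∷ [])) r
              ≈ p * coeff (act u (α a)) r + q * coeff (act u (α b)) r
  act-plane u a b p q r = trans (act-∷ u a p ((b , q) ∷ []) r) (+-congˡ (trans (act-∷ u b q [] r)
    (trans (+-congˡ (act-[] u r)) (+-identityʳ _))))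

  act-∷ʳ-self : ∀ u s r → coeff (act (u ∷ʳ s) (α s)) r ≈ - coeff (act u (α s)) r
  act-∷ʳ-self u s r = trans (reflexive (≡.cong (λ v → coeff v r) (act-++ u (s ∷ []) (α s))))
    (trans (act-plane u s s _ 1# r) (trans (+-congʳ (*-congʳ (-‿cong (*-congˡ (B-α-self s)))))
    (solve 1 (λ c → :- ((:1 :+ :1) :* :1) :* c :+ :1 :* c := :- c) refl _)))

  U-nonneg : ∀ M k → M ≢ 1 → M ≡ 0 ⊎ k ≤ M → 0# ≤ᴷ U (formEntry M) k
  U-nonneg zero          k M≢1 _            = U-nonneg-infinite k
  U-nonneg (suc zero)    k M≢1 _            = ⊥-elim (M≢1 ≡.refl)
  U-nonneg (suc (suc n)) k M≢1 (inj₂ k≤M)   = U-nonneg-finite (isCosSinπ/ (2 ℕ.+ n)) (sin-pos n) k k≤M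

  U-half-turn : ∀ n k → U (formEntry (2 ℕ.+ n)) (k ℕ.+ (2 ℕ.+ n)) ≈ - U (formEntry (2 ℕ.+ n)) k
  U-half-turn n = half-turn (isCosSinπ/ (2 ℕ.+ n)) (sin-pos n) (U (formEntry (2 ℕ.+ n))) (λ _ → refl)

  -- A stage in the search for the minimal element v of the coset of u modulo the
  -- dihedral group generated by a and b; the field k is the length of x.
  record Factorisation (u : Word) (r : S) : Set (ℓ₁ ⊔ ℓ ⊔ s) where
    field
      v x         : Word
      a b         : S
      k           : ℕ
      mab≢1       : m a b ≢ 1
      u≈vax       : ⟦ u ⟧ ≈ᵂ ⟦ v ++ a ∷ x ⟧
      shorter     : length v ℕ.+ suc (length x) ≤ length u
      alternates  : a ∷ x ∷ʳ r ≡ alternating a b (2 ℕ.+ k)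
      coordinates : act (a ∷ x) (α r) ≈ⱽ
                      (a , U (formEntry (m a b)) (2 ℕ.+ k)) ∷ (b , U (formEntry (m a b)) (1 ℕ.+ k)) ∷ []
      bound       : m a b ≡ 0 ⊎ 1 ℕ.+ k ≤ m a b

  module _ {u : Word} {r : S} (F : Factorisation u r) where
    open Factorisation F

    e : Carrier
    e = formEntry (m a b)

    length-x : length x ≡ k
    length-x = ℕ.suc-injective (ℕ.suc-injective (begin
      2 ℕ.+ length x                      ≡⟨ ≡.cong suc (ℕ.+-comm 1 (length x)) ⟩
      suc (length x ℕ.+ 1)                ≡⟨ ≡.cong suc (List.length-++ x) ⟨
      length (a ∷ x ∷ʳ r)                 ≡⟨ ≡.cong length alternates ⟩
      length (alternating a b (2 ℕ.+ k))  ≡⟨ length-alternating a b (2 ℕ.+ k) ⟩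
      2 ℕ.+ k                             ∎))
      where open ≡.≡-Reasoning

    v-shorter : length v < length u
    v-shorter = ℕ.≤-trans (ℕ.≤-trans (ℕ.≤-reflexive (ℕ.+-comm 1 (length v)))
      (ℕ.+-monoʳ-≤ (length v) (ℕ.s≤s ℕ.z≤n))) shorter

    -- Reduces the sign of u(α r) to those of v(α a) and v(α b), with weights sin((k+2)θ)/sin θ and
    -- sin((k+1)θ)/sin θ when m(a,b) is finite.
    coeff-act : ∀ q → coeff (act u (α r)) q
                      ≈ U e (2 ℕ.+ k) * coeff (act v (α a)) q + U e (1 ℕ.+ k) * coeff (act v (α b)) q
    coeff-act q = trans (act-resp {u} {v ++ a ∷ x} u≈vax (α r) q)
      (trans (reflexive (≡.cong (λ z → coeff z q) (act-++ v (a ∷ x) (α r))))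
      (trans (act-cong v {act (a ∷ x) (α r)} coordinates q) (act-plane v a b _ _ q)))

    positive : m a b ≡ 0 ⊎ 2 ℕ.+ k ≤ m a b → Nonneg (act v (α a)) → Nonneg (act v (α b)) → Nonneg (act u (α r))
    positive bound′ 0≤a 0≤b q = 0≤-resp (sym (coeff-act q)) (0≤-+
      (0≤-* (U-nonneg (m a b) (2 ℕ.+ k) mab≢1 bound′) (0≤a q))
      (0≤-* (U-nonneg (m a b) (1 ℕ.+ k) mab≢1 bound) (0≤b q)))

    -- At k + 1 = m the two weights are -1 and 0, so u(α r) = -v(α a). The word a x r then has m + 1
    -- letters, and the braid relation leaves k of them, which gives the shorter word for u r.
    negative : m a b ≡ 1 ℕ.+ k → Nonneg (act v (α a)) → Nonpos (act u (α r)) × RightDescent u r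
    negative mab≡1+k 0≤a = (λ q → 0≤-resp (sym (flipped q)) (0≤a q)) , v ++ alternating b a k , v++<u , u≈
      where
      U-values : ∀ M → M ≢ 1 → M ≡ 1 ℕ.+ k →
                 U (formEntry M) (1 ℕ.+ k) ≈ - 0# × U (formEntry M) (2 ℕ.+ k) ≈ - 1#
      U-values (suc zero)    M≢1 _      = ⊥-elim (M≢1 ≡.refl)
      U-values (suc (suc n)) _   ≡.refl = U-half-turn n 0 , U-half-turn n 1

      flipped : ∀ q → - coeff (act u (α r)) q ≈ coeff (act v (α a)) q
      flipped q with U-values (m a b) mab≢1 mab≡1+k
      ... | U≈0 , U≈-1 = trans (-‿cong (trans (coeff-act q) (+-cong (*-congʳ U≈-1) (*-congʳ U≈0))))
        (solve 2 (λ c d → :- (:- :1 :* c :+ :- :0 :* d) := c) refl _ _)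

      v++<u : length (v ++ alternating b a k) < length u
      v++<u = ℕ.≤-trans (ℕ.≤-reflexive (≡.trans (≡.cong suc (≡.trans (List.length-++ v)
        (≡.cong (length v ℕ.+_) (≡.trans (length-alternating b a k) (≡.sym length-x)))))
        (≡.sym (ℕ.+-suc (length v) (length x))))) shorter

      u≈ : ⟦ u ⟧ ≈ᵂ ⟦ (v ++ alternating b a k) ∷ʳ r ⟧
      u≈ = ∷ʳ-transpose u r (v ++ alternating b a k) (W.trans (⟦⟧-congˡ u (v ++ a ∷ x) (r ∷ []) u≈vax)
        (W.trans (W.reflexive (≡.cong ⟦_⟧ (≡.trans (List.++-assoc v (a ∷ x) (r ∷ [])) (≡.cong (v ++_) alternates))))
        (⟦⟧-congʳ v (alternating a b (2 ℕ.+ k)) (alternating b a k) (braid a b k mab≡1+k))))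

    -- Substituting v = v′ a into v a x makes two adjacent letters `a` cancel.
    shortened : RightDescent v a → ∃[ u′ ] length u′ < length u × ⟦ u ⟧ ≈ᵂ ⟦ u′ ⟧
    shortened (v′ , v′<v , v≈v′a) = v′ ++ x , v′x<u , W.trans u≈vax (W.trans
      (⟦⟧-congˡ v (v′ ∷ʳ a) (a ∷ x) v≈v′a)
      (W.trans (W.reflexive (≡.cong ⟦_⟧ (List.++-assoc v′ (a ∷ []) (a ∷ x))))
      (⟦⟧-congʳ v′ (a ∷ a ∷ x) x (simple-cancel a ⟦ x ⟧))))
      where
      v′x<u : length (v′ ++ x) < length u
      v′x<u = ℕ.<-≤-trans (ℕ.≤-<-trans (ℕ.≤-reflexive (List.length-++ v′))
        (ℕ.+-mono-<-≤ v′<v (ℕ.n≤1+n (length x)))) shorter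

    -- Substituting v = v′ b moves `b` in front of a x: the letters exchange roles and the
    -- coordinates advance by one term. The equation for `v` in the result lets the caller recurse
    -- on its length.
    extended : m a b ≡ 0 ⊎ 2 ℕ.+ k ≤ m a b → ((v′ , _) : RightDescent v b) →
               ∃[ F′ ] Factorisation.v {u} {r} F′ ≡ v′
    extended bound′ (v′ , v′<v , v≈v′b) = record
      { v           = v′
      ; x           = a ∷ x
      ; a           = b
      ; b           = a
      ; k           = suc k
      ; mab≢1       = mab≢1 ∘ ≡.trans (m-sym a b)
      ; u≈vax       = W.trans u≈vax (W.trans (⟦⟧-congˡ v (v′ ∷ʳ b) (a ∷ x) v≈v′b)
                        (W.reflexive (≡.cong ⟦_⟧ (List.++-assoc v′ (b ∷ []) (a ∷ x)))))
      ; shorter     = ℕ.≤-trans (ℕ.≤-reflexive (ℕ.+-suc (length v′) (suc (length x))))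
                        (ℕ.≤-trans (ℕ.+-monoˡ-≤ (suc (length x)) v′<v) shorter)
      ; alternates  = ≡.cong (b ∷_) alternates
      ; coordinates = λ q → trans (σ-cong b {act (a ∷ x) (α r)} {plane (m b a)} coordinates′ q)
                        (σ-plane b a _ _ [] refl q)
      ; bound       = ≡.subst (λ M → M ≡ 0 ⊎ 2 ℕ.+ k ≤ M) (m-sym a b) bound′
      } , ≡.refl
      where
      plane : ℕ → V
      plane M = (a , U (formEntry M) (2 ℕ.+ k)) ∷ (b , U (formEntry M) (1 ℕ.+ k)) ∷ []

      coordinates′ : act (a ∷ x) (α r) ≈ⱽ plane (m b a)
      coordinates′ = ≡.subst (λ M → act (a ∷ x) (α r) ≈ⱽ plane M) (m-sym a b) coordinates

  bound-cases : ∀ {M j} → M ≡ 0 ⊎ j ≤ M → M ≡ j ⊎ (M ≡ 0 ⊎ suc j ≤ M)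
  bound-cases (inj₁ M≡0) = inj₂ (inj₁ M≡0)
  bound-cases (inj₂ j≤M) with ℕ.m≤n⇒m<n∨m≡n j≤M
  ... | inj₁ j<M = inj₂ (inj₂ j<M)
  ... | inj₂ j≡M = inj₁ (≡.sym j≡M)

  initial : ∀ w t r → t ≢ r → Factorisation (w ∷ʳ t) r
  initial w t r t≢r = record
    { v           = w
    ; x           = []
    ; a           = t
    ; b           = r
    ; k           = 0
    ; mab≢1       = t≢r ∘ Equivalence.to (m≡1⇔≡ t r)
    ; u≈vax       = W.refl
    ; shorter     = ℕ.≤-reflexive (≡.sym (List.length-++ w))
    ; alternates  = ≡.refl
    -- Here U(2) = -2e and U(1) = 1 are the coordinates of the image of `α r` under the reflection
    -- in `α t`.
    ; coordinates = λ q → select (does (t ≟ q)) (if does (r ≟ q) then 1# else 0#)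
    ; bound       = nonzero (m t r)
    }
    where
    nonzero : ∀ M → M ≡ 0 ⊎ 1 ≤ M
    nonzero zero    = inj₁ ≡.refl
    nonzero (suc _) = inj₂ (ℕ.s≤s ℕ.z≤n)

    e′ : Carrier
    e′ = formEntry (m t r)

    select : ∀ β y → (if β then - ((1# + 1#) * (1# * e′ + 0#)) else 0#) + (y + 0#)
                   ≈ (if β then - ((1# + 1#) * e′) * 1# - 0# else 0#) + (y + 0#)
    select true  y = solve 2 (λ e y → :- ((:1 :+ :1) :* (:1 :* e :+ :0)) :+ (y :+ :0)
                                   := (:- ((:1 :+ :1) :* e) :* :1 :- :0) :+ (y :+ :0)) refl e′ y
    select false y = refl

  -- Nested induction: `n` bounds the length of `u` from above, and inside it `j` bounds that of
  -- `v`, which drops whenever a letter moves to `x`. As `v` is shorter than `u`, the outer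
  -- induction gives the signs of v(α a) and v(α b).
  signed≤ : ∀ n u r → length u ≤ n → Signed u r
  signedFactorisation : ∀ n {u r} → length u ≤ suc n → (F : Factorisation u r) →
                        ∀ j → length (Factorisation.v F) ≤ j → Signed u r

  signed≤ n u r u≤n with initLast u
  signed≤ n       .[]        r u≤n | []      = inj₁ λ q → select (does (r ≟ q))
    where
    select : ∀ β → 0# ≤ᴷ (if β then 1# else 0#) + 0#
    select true  = 0≤-+ (0<⇒0≤ 0<1) (0≤0 refl)
    select false = 0≤-+ (0≤0 refl) (0≤0 refl)
  signed≤ zero    .(w ∷ʳ t) r u≤n | w ∷ʳ′ t =
    ⊥-elim (ℕ.n≮0 (ℕ.≤-trans (ℕ.≤-reflexive (≡.sym (length-∷ʳ w t))) u≤n))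
  signed≤ (suc n) .(w ∷ʳ t) r u≤n | w ∷ʳ′ t with t ≟ r
  ... | no t≢r     = signedFactorisation n u≤n (initial w t r t≢r) (length w) ℕ.≤-refl
  -- The last letter negates `α t`, so the sign is opposite to that of w(α t); in the nonpositive
  -- case `w` itself is the shorter word.
  ... | yes ≡.refl with signed≤ n w t (ℕ.s≤s⁻¹ (ℕ.≤-trans (ℕ.≤-reflexive (≡.sym (length-∷ʳ w t))) u≤n))
  ...   | inj₁ 0≤       = inj₂ ((λ q → 0≤-resp (trans (solve 1 (λ c → c := :- :- c) refl _)
                            (-‿cong (sym (act-∷ʳ-self w t q)))) (0≤ q))
                          , w , ℕ.≤-reflexive (≡.sym (length-∷ʳ w t)) , W.refl)
  ...   | inj₂ (≤0 , _) = inj₁ λ q → 0≤-resp (sym (act-∷ʳ-self w t q)) (≤0 q)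

  signedFactorisation n {u} {r} u≤1+n F j v≤j with signed≤ n v a v≤n
    where
    open Factorisation F
    v≤n : length v ≤ n
    v≤n = ℕ.s≤s⁻¹ (ℕ.≤-trans (v-shorter F) u≤1+n)
  -- A descent of `v` at `a` shows that `u` was not reduced, so the outer induction applies to the
  -- shorter word.
  ... | inj₂ (_ , descent) with shortened F descent
  ...   | u′ , u′<u , u≈u′ =
    Signed-resp {u} {u′} u≈u′ (ℕ.<⇒≤ u′<u) (signed≤ n u′ r (ℕ.s≤s⁻¹ (ℕ.≤-trans u′<u u≤1+n)))
  signedFactorisation n {u} {r} u≤1+n F j v≤j | inj₁ 0≤a with bound-cases (Factorisation.bound F)
  ... | inj₁ m≡1+k = inj₂ (negative F m≡1+k 0≤a)
  ... | inj₂ bound′ with signed≤ n (Factorisation.v F) (Factorisation.b F)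
                         (ℕ.s≤s⁻¹ (ℕ.≤-trans (v-shorter F) u≤1+n))
  ...   | inj₁ 0≤b = inj₁ (positive F bound′ 0≤a 0≤b)
  ...   | inj₂ (_ , descent@(v′ , v′<v , _)) with j | extended F bound′ descent
  ...     | zero   | _             = ⊥-elim (ℕ.n≮0 (ℕ.<-≤-trans v′<v v≤j))
  ...     | suc j′ | F′ , ≡.refl   = signedFactorisation n u≤1+n F′ j′ (ℕ.s≤s⁻¹ (ℕ.<-≤-trans v′<v v≤j))

  signed : ∀ u r → Signed u r
  signed u r = signed≤ (length u) u r ℕ.≤-refl

-- Faithfulness of the geometric representation.

module Depth {c ℓ₁ ℓ₂ ℓ₃ w ℓ s}
  (K : TrigField c ℓ₁ ℓ₂ ℓ₃) (C : CoxeterSystem w ℓ s) where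
  open CoxeterWords C
  open GeometricRepresentation K C
  open WellDefinedAction K C
  open SignTheorem K C
  open TrigField K hiding (zero; _<_; _≤_)
  open TrigField K using () renaming (_≤_ to _≤ᴷ_)
  open CoxeterSystem C renaming (_≈_ to _≈ᵂ_)
  open RootSystem K C
  open import Data.Nat.Base using (_<_; _≤_)

  coeff-same : ∀ s a → coeff ((s , a) ∷ []) s ≈ a
  coeff-same s a = trans (+-identityʳ _) (reflexive (≡.cong (if_then a else 0#) (dec-true (s ≟ s) ≡.refl)))

  coeff-other : ∀ {s t} a v → s ≢ t → coeff ((s , a) ∷ v) t ≈ coeff v t
  coeff-other {s} {t} a v s≢t = trans
    (+-congʳ (reflexive (≡.cong (if_then a else 0#) (dec-false (s ≟ t) s≢t)))) (+-identityˡ _)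

  -- If u = w t fixes `α t`, then w(α t) = -α t is not nonnegative. By the sign theorem `w` has a
  -- descent at `t`, and cancelling it gives a shorter word for the same element, with the same
  -- action.
  trivial-action : ∀ n u → length u ≤ n → (∀ s → act u (α s) ≈ⱽ α s) → ⟦ u ⟧ ≈ᵂ ε
  trivial-action n       u            u≤n fixed with initLast u
  trivial-action n       .[]          u≤n fixed | []      = W.refl
  trivial-action zero    .(w ∷ʳ t) u≤n fixed | w ∷ʳ′ t =
    ⊥-elim (ℕ.n≮0 (ℕ.≤-trans (ℕ.≤-reflexive (≡.sym (length-∷ʳ w t))) u≤n))
  trivial-action (suc n) .(w ∷ʳ t) u≤n fixed | w ∷ʳ′ t with signed w t
  ... | inj₁ 0≤w = ⊥-elim (0≤w t (<-respˡ
          (trans (-‿cong (trans (sym (coeff-same t 1#)) (trans (sym (fixed t t)) (act-∷ʳ-self w t t))))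
            (solve 1 (λ c → :- (:- c) := c) refl _)) (0<x⇒-x<0 0<1)))
  ... | inj₂ (_ , w′ , w′<w , w≈w′t) = W.trans u≈w′ (trivial-action n w′
          (ℕ.≤-trans (ℕ.<⇒≤ w′<w) (ℕ.s≤s⁻¹ u≤n′))
          (λ s r → trans (act-resp {w′} {w ∷ʳ t} (W.sym u≈w′) (α s) r) (fixed s r)))
    where
    u≤n′ : suc (length w) ≤ suc n
    u≤n′ = ℕ.≤-trans (ℕ.≤-reflexive (≡.sym (length-∷ʳ w t))) u≤n
    u≈w′ : ⟦ w ∷ʳ t ⟧ ≈ᵂ ⟦ w′ ⟧
    u≈w′ = W.trans (⟦⟧-congˡ w (w′ ∷ʳ t) (t ∷ []) w≈w′t) (∷ʳ-cancel w′ t)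

  faithful : ∀ u u′ → (∀ v → act u v ≈ⱽ act u′ v) → ⟦ u ⟧ ≈ᵂ ⟦ u′ ⟧
  faithful u []       same = trivial-action (length u) u ℕ.≤-refl (λ s → same (α s))
  faithful u (s ∷ u′) same = simple-transpose s (faithful (s ∷ u) u′ (λ v r →
    trans (σ-cong s {act u v} {act (s ∷ u′) v} (same v) r) (σ-involutive s (act u′ v) r)))

  -- By faithfulness, it is enough that u r and s u act alike. Invariance of the form gives B(α r,
  -- v) = B(α s, u v), so `u` carries the reflection formula for `r` to that for `s`.
  reflection-of-simple : ∀ u r s → act u (α r) ≈ⱽ α s → ⟦ u ⟧ ∙ simple r ∙ ⟦ u ⟧ ⁻¹ ≈ᵂ simple s
  reflection-of-simple u r s uαr≈αs = begin
    ⟦ u ⟧ ∙ simple r ∙ ⟦ u ⟧ ⁻¹        ≈⟨ W.∙-congʳ (W.∙-congˡ (W.identityʳ (simple r))) ⟨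
    ⟦ u ⟧ ∙ (simple r ∙ ε) ∙ ⟦ u ⟧ ⁻¹  ≈⟨ W.∙-congʳ (⟦++⟧ u (r ∷ [])) ⟨
    ⟦ u ∷ʳ r ⟧ ∙ ⟦ u ⟧ ⁻¹              ≈⟨ W.∙-congʳ (faithful (u ∷ʳ r) (s ∷ u) same) ⟩
    simple s ∙ ⟦ u ⟧ ∙ ⟦ u ⟧ ⁻¹        ≈⟨ W.assoc _ _ _ ⟩
    simple s ∙ (⟦ u ⟧ ∙ ⟦ u ⟧ ⁻¹)      ≈⟨ W.∙-congˡ (W.inverseʳ _) ⟩
    simple s ∙ ε                       ≈⟨ W.identityʳ _ ⟩
    simple s ∎
    where
    open import Relation.Binary.Reasoning.Setoid W.setoid

    B-act : ∀ v → B⟨α r , v ⟩ ≈ B⟨α s , act u v ⟩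
    B-act v = trans (sym (form-α r v)) (trans (sym (form-act u (α r) v))
      (trans (form-congˡ {act u (α r)} {α s} (act u v) uαr≈αs) (form-α s (act u v))))

    same : ∀ v → act (u ∷ʳ r) v ≈ⱽ act (s ∷ u) v
    same v q = trans (reflexive (≡.cong (λ z → coeff z q) (act-++ u (r ∷ []) v)))
      (trans (act-∷ u r _ v q) (+-congʳ (trans
        (*-cong (-‿cong (*-congˡ (B-act v))) (uαr≈αs q)) (select (does (s ≟ q))))))
      where
      select : ∀ β {κ} → κ * ((if β then 1# else 0#) + 0#) ≈ (if β then κ else 0#)
      select true  = solve 1 (λ κ → κ :* (:1 :+ :0) := κ) refl _
      select false = solve 1 (λ κ → κ :* (:0 :+ :0) := :0) refl _

  -- Roots of depth one.

  -- The empty word would make β both nonnegative and nonpositive, hence zero, against B(β,β) = 1.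
  negative⇒nonempty : ∀ {β} u → IsPositiveRoot β → IsNegativeRoot (act u β) → 1 ≤ length u
  negative⇒nonempty {β} [] (root , 0≤β) (_ , β≤0) = ⊥-elim (root≉0 {β} root
    (λ s → 0≤-antisym (0≤β s) (0≤-resp (coeff-negⱽ β s) (β≤0 s))))
  negative⇒nonempty (_ ∷ _) _ _ = ℕ.s≤s ℕ.z≤n

  -- The reflection changes only the coefficient at `s`, so all others are both nonnegative and
  -- nonpositive. Hence β = a α s with a ≥ 0, and a² = B(β,β) = 1.
  positive∧σ-negative⇒simple : ∀ {β} s → IsPositiveRoot β → IsNegativeRoot (σ s β) → β ≈ⱽ α s
  positive∧σ-negative⇒simple {β} s ((u , r , β≈uαr) , 0≤β) (_ , σβ≤0) q =
    trans (β≈aα q) (+-congʳ (if-cong (does (s ≟ q)) (0≤∧²≈1⇒≈1 (0≤β s) a²≈1)))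
    where
    a : Carrier
    a = coeff β s

    β≈aα : β ≈ⱽ (s , a) ∷ []
    β≈aα q with s ≟ q
    ... | yes ≡.refl = sym (coeff-same s a)
    ... | no s≢q     = trans (0≤-antisym (0≤β q) (0≤-resp (trans (coeff-negⱽ (σ s β) q)
                         (-‿cong (coeff-other _ β s≢q))) (σβ≤0 q))) (sym (coeff-other a [] s≢q))

    a²≈1 : a * a ≈ 1#
    a²≈1 = trans (sym (trans (form-congˡ {β} {(s , a) ∷ []} β β≈aα) (trans (+-congʳ (*-congˡ
      (trans (B-cong s {β} {(s , a) ∷ []} β≈aα) (+-congʳ (*-congˡ (formEntry-self s))))))
      (solve 1 (λ a → a :* (a :* :1 :+ :0) :+ :0 := a :* a) refl a)))) (form-root {β} u r β≈uαr)

  simple-conjugate : ∀ s → simple s ≈ᵂ ε ∙ simple s ∙ ε ⁻¹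
  simple-conjugate s = W.sym (W.trans (W.∙-cong (W.identityˡ _)
    (W.trans (W.sym (W.identityˡ _)) (W.inverseʳ ε))) (W.identityʳ _))

  simple-isReflection : ∀ s → IsReflection (simple s)
  simple-isReflection s = ε , s , simple-conjugate s

  α-positive : ∀ s → IsPositiveRoot (α s)
  α-positive s = ([] , s , λ _ → refl) , λ q → select (does (s ≟ q))
    where
    select : ∀ β → 0# ≤ᴷ (if β then 1# else 0#) + 0#
    select true  = 0≤-resp (sym (+-identityʳ _)) (0<⇒0≤ 0<1)
    select false = 0≤0 (+-identityʳ _)

  σ-α-negative : ∀ s → IsNegativeRoot (σ s (α s))
  σ-α-negative s = ([] , s , -σα≈α) , λ q → 0≤-resp (sym (-σα≈α q)) (proj₂ (α-positive s) q)
    where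
    -σα≈α : negⱽ (σ s (α s)) ≈ⱽ α s
    -σα≈α q = trans (coeff-negⱽ (σ s (α s)) q) (trans (-‿cong (act-∷ʳ-self [] s q))
      (solve 1 (λ c → :- (:- c) := c) refl _))

  simpleFactor : S → Factor
  simpleFactor s = record
    { root         = α s
    ; positive     = α-positive s
    ; reflection   = simple s
    ; isReflection = [] , s , (λ _ → refl) , simple-conjugate s
    ; depth        = 1
    ; isDepth      = (s ∷ [] , ≡.refl , σ-α-negative s)
                   , λ { _ (u , ≡.refl , negative) → negative⇒nonempty {α s} u (α-positive s) negative }
    }

  1≤depth : ∀ f → 1 ≤ Factor.depth f
  1≤depth f with proj₁ (Factor.isDepth f)
  ... | u , ≡.refl , negative = negative⇒nonempty {Factor.root f} u (Factor.positive f) negative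

  -- The one-letter word `s` realising the depth identifies the root with `α s`. The reflection was
  -- given by an arbitrary presentation u(α r) of that root, which `reflection-of-simple` allows.
  depth-1⇒simple : ∀ f → Factor.depth f ≡ 1 → ∃[ s ] Factor.reflection f ≈ᵂ simple s
  depth-1⇒simple f d≡1 with proj₁ (Factor.isDepth f) | Factor.isReflection f
  ... | []        , 0≡d , _        | _ = ⊥-elim (ℕ.0≢1+n (≡.trans 0≡d d≡1))
  ... | _ ∷ _ ∷ _ , l≡d , _        | _ = ⊥-elim (ℕ.1+n≢0 (ℕ.suc-injective (≡.trans l≡d d≡1)))
  ... | s ∷ []    , _   , negative | u , r , β≈uαr , t≈uru⁻¹ = s , W.trans t≈uru⁻¹
    (reflection-of-simple u r s (λ q → trans (sym (β≈uαr q))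
      (positive∧σ-negative⇒simple {Factor.root f} s (Factor.positive f) negative q)))

  -- Comparison of depth, length and reflection length.

  length≤depth : ∀ fs → length fs ≤ sum (map Factor.depth fs)
  length≤depth []       = ℕ.z≤n
  length≤depth (f ∷ fs) = ℕ.+-mono-≤ (1≤depth f) (length≤depth fs)

  -- All depths are at least 1, so a total no larger than the number of factors forces each of them
  -- to be 1.
  simple-word : ∀ fs → sum (map Factor.depth fs) ≤ length fs →
                ∃[ u ] length u ≡ length fs × product (map Factor.reflection fs) ≈ᵂ ⟦ u ⟧
  simple-word []       _       = [] , ≡.refl , W.refl
  simple-word (f ∷ fs) d+Σ≤1+l with simple-word fs Σ≤l | depth-1⇒simple f d≡1
    where
    Σ≤l : sum (map Factor.depth fs) ≤ length fs
    Σ≤l = ℕ.s≤s⁻¹ (ℕ.≤-trans (ℕ.+-monoˡ-≤ _ (1≤depth f)) d+Σ≤1+l)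
    d≡1 : Factor.depth f ≡ 1
    d≡1 = ℕ.≤-antisym (ℕ.+-cancelʳ-≤ (length fs) _ 1
      (ℕ.≤-trans (ℕ.+-monoʳ-≤ (Factor.depth f) (length≤depth fs)) d+Σ≤1+l)) (1≤depth f)
  ... | u , |u|≡l , Πfs≈u | s , t≈s = s ∷ u , ≡.cong suc |u|≡l , W.∙-cong t≈s Πfs≈u

  reflectionLength≤factors : ∀ {x n} → IsReflectionLength x n →
    ∀ fs → x ≈ᵂ product (map Factor.reflection fs) → n ≤ length fs
  reflectionLength≤factors (_ , minimal) fs x≈ = minimal (length fs)
    (map Factor.reflection fs , List.length-map Factor.reflection fs
    , All.map⁺ (All.universal factor-isReflection fs) , x≈)
    where
    factor-isReflection : ∀ f → IsReflection (Factor.reflection f)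
    factor-isReflection f with Factor.isReflection f
    ... | u , s , _ , t≈usu⁻¹ = ⟦ u ⟧ , s , t≈usu⁻¹

  reflectionLength≤length : ∀ {x n} → IsReflectionLength x n → ∀ u → x ≈ᵂ ⟦ u ⟧ → n ≤ length u
  reflectionLength≤length (_ , minimal) u x≈u = minimal (length u)
    (map simple u , List.length-map simple u , All.map⁺ (All.universal simple-isReflection u) , x≈u)

  minimal-depth⇔minimal-length : ∀ x →
    (∃[ n ] IsDepth x n × IsReflectionLength x n) ⇔ (∃[ n ] IsLength x n × IsReflectionLength x n)
  minimal-depth⇔minimal-length x = mk⇔ to from
    where
    to : ∃[ n ] IsDepth x n × IsReflectionLength x n → ∃[ n ] IsLength x n × IsReflectionLength x n
    to (n , ((fs , Σ≡n , x≈Πfs) , _) , ℓT) with reflectionLength≤factors ℓT fs x≈Πfs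
    -- The number of factors lies between `n` and the total depth, which is also `n`.
    ... | n≤l with simple-word fs (ℕ.≤-trans (ℕ.≤-reflexive Σ≡n) n≤l)
    ... | u , |u|≡l , Πfs≈u = n , (
        (u , ≡.trans |u|≡l (ℕ.≤-antisym (ℕ.≤-trans (length≤depth fs) (ℕ.≤-reflexive Σ≡n)) n≤l)
        , W.trans x≈Πfs Πfs≈u)
      , λ { _ (v , ≡.refl , x≈v) → reflectionLength≤length ℓT v x≈v }) , ℓT

    from : ∃[ n ] IsLength x n × IsReflectionLength x n → ∃[ n ] IsDepth x n × IsReflectionLength x n
    from (n , ((u , |u|≡n , x≈u) , _) , ℓT) = n , ((map simpleFactor u , ≡.trans (depth-u u) |u|≡n
        , W.trans x≈u (W.reflexive (≡.cong product (List.map-∘ u))))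
      -- Any competing expression has at least `n` factors, each of depth at least 1.
      , λ { _ (fs , ≡.refl , x≈Πfs) →
          ℕ.≤-trans (reflectionLength≤factors ℓT fs x≈Πfs) (length≤depth fs) }) , ℓT
      where
      depth-u : ∀ u → sum (map Factor.depth (map simpleFactor u)) ≡ length u
      depth-u []      = ≡.refl
      depth-u (s ∷ u) = ≡.cong suc (depth-u u)

mainTheorem5 : ∀ {c ℓ₁ ℓ₂ ℓ₃ a ℓ s} (K : TrigField c ℓ₁ ℓ₂ ℓ₃) (C : CoxeterSystem a ℓ s) →
    let open CoxeterSystem C
        open RootSystem K C
    in (w : W) →
       (∃[ n ] IsDepth w n × IsReflectionLength w n) ⇔ (∃[ n ] IsLength w n × IsReflectionLength w n)
mainTheorem5 K C = Depth.minimal-depth⇔minimal-length K C
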